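{- Let $C$ be the absolute constant described in the context. For every integer $m>6C^2(C+1)$, $$R_m=\begin{cases}m-2 & \text{ when } m\not\equiv 2 \pmod{3},\\ m-3 & \text{ when } m\equiv 2 \pmod{3},\end{cases}$$ where $R_m$ is the maximal rank of a leaf of the escalator tree of $m$-gonal forms.
   Context: For an integer $m\ge 3$ and $x\in\mathbb Z$, let $P_m(x)=\frac{m-2}{2}x^2-\frac{m-4}{2}x$. An $m$-gonal form of rank $n$ is $F(\mathbf x)=\sum_{i=1}^n a_iP_m(x_i)$ with positive integers $a_1\le\cdots\le a_n$; it represents a positive integer $N$ if $F(\mathbf x)=N$ for some $\mathbf x\in\mathbb Z^n$, and it is universal if it represents every positive integer. The truant of a non-universal form is the smallest positive integer it does not represent. The escalator tree of $m$-gonal forms is the rooted tree whose root is the empty form (rank $0$, truant $1$); if a node $\sum_{i=1}^k a_iP_m(x_i)$ is not universal, with truant $T$, its children are all forms $\sum_{i=1}^{k+1}a_iP_m(x_i)$ with $a_{k+1}\ge a_k$ (any $a_1\ge1$ if $k=0$) which represent $T$; a universal node has no children. The leaves are exactly the universal nodes. $R_m$ denotes the maximal rank of a leaf. $C$ denotes a fixed absolute constant such that, for every $m\ge3$, every $m$-gonal form that represents every positive integer up to $C(m-2)$ is universal (the existence of such a constant is a known result). -}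

module Defs where

open import Data.Nat as ℕ using (ℕ; zero; suc)
open import Data.Integer as ℤ using (ℤ; +_)
open import Data.Integer.DivMod using () renaming (_/_ to _div_)
open import Data.Rational.Unnormalised as ℚᵘ using (ℚᵘ)
open import Data.List using (List; []; _∷_; _∷ʳ_; length)
open import Data.List.Relation.Unary.All using (All)
open import Data.List.Relation.Unary.Linked using (Linked)
open import Data.List.Relation.Unary.Any using (Any)
open import Data.List.Relation.Binary.Pointwise using (Pointwise)
open import Data.Product using (Σ; _×_; ∃)
open import Relation.Binary.PropositionalEquality using (_≡_)
open import Relation.Nullary using (¬_)

-- The m-gonal number P_m(x) = ((m-2) x^2 - (m-4) x) / 2  (numerator always even).
P : ℕ → ℤ → ℤ
P m x = ((+ m ℤ.- + 2) ℤ.* x ℤ.* x ℤ.- (+ m ℤ.- + 4) ℤ.* x) div (+ 2)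

-- An m-gonal form  Σ a_i P_m(x_i)  is given by its coefficient list [a_1, …, a_n].
-- Value of the form at x (coefficients paired with variables; extra entries ignored,
-- but representations below always use a vector of the same length).
eval : ℕ → List ℕ → List ℤ → ℤ
eval m []       _        = + 0
eval m (_ ∷ _)  []       = + 0
eval m (a ∷ as) (x ∷ xs) = + a ℤ.* P m x ℤ.+ eval m as xs

IsForm : List ℕ → Set
IsForm as = All (1 ℕ.≤_) as × Linked ℕ._≤_ as

Represents : ℕ → List ℕ → ℕ → Set
Represents m as N = Σ (List ℤ) λ xs → (length xs ≡ length as) × (eval m as xs ≡ + N)

Universal : ℕ → List ℕ → Set
Universal m as = ∀ N → 1 ℕ.≤ N → Represents m as N

IsTruant : ℕ → List ℕ → ℕ → Set
IsTruant m as T =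
  (1 ℕ.≤ T) × ¬ Represents m as T × (∀ k → 1 ℕ.≤ k → k ℕ.< T → Represents m as k)

-- Lower bound for the next coefficient: a_{k+1} ≥ a_k, or a_1 ≥ 1 when k = 0.
LastBound : List ℕ → ℕ
LastBound []       = 1
LastBound (a ∷ []) = a
LastBound (_ ∷ as@(_ ∷ _)) = LastBound as

data Node (m : ℕ) : List ℕ → Set where
  root  : Node m []
  child : ∀ {as} (a T : ℕ) → Node m as → IsTruant m as T →
          LastBound as ℕ.≤ a → Represents m (as ∷ʳ a) T → Node m (as ∷ʳ a)

Leaf : ℕ → List ℕ → Set
Leaf m as = Node m as × Universal m as

MaxLeafRank : ℕ → ℕ → Set
MaxLeafRank m r =
  (Σ (List ℕ) λ as → Leaf m as × length as ≡ r) ×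
  (∀ as → Leaf m as → length as ℕ.≤ r)

GoodConstant : ℚᵘ → Set
GoodConstant C =
  ∀ m → 3 ℕ.≤ m → ∀ as → IsForm as →
  (∀ N → 1 ℕ.≤ N → (+ N ℚᵘ./ 1) ℚᵘ.≤ C ℚᵘ.* (+ (m ℕ.∸ 2) ℚᵘ./ 1) → Represents m as N) →
  Universal m as

{-# OPTIONS --safe #-}
module Submission where

-- Put q = m - 3 and write a value of a form as q A + D, where A = Σ aᵢ xᵢ(xᵢ-1)/2 and
-- D = Σ aᵢ xᵢ(xᵢ+1)/2.  The truant of a node exceeds the sum of its coefficients, and it is less
-- than K (m - 2), where K = ⌊C⌋ + 1.
--
-- Upper bound.  Let T be the truant of a node of rank at least q.  If a coefficient v occurs at
-- least K + 3 times, then changing a variable of v from 0 to -1, or three of them from (1 , 1 , 1)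
-- to (2 , 0 , 0), adds v to A and keeps D.  If T ≥ v q, then T - v q is represented by minimality of
-- T, and hence so is T; thus T < v q.  Take the least such v.  Few coefficients are smaller, and comparing the
-- sum of the coefficients with v q shows that few are larger.  The smaller ones, bs, satisfy
-- b ≤ 1 + (sum of the previous ones), and a finite search shows that for some 1 ≤ A < v they attain
-- with this A all residues of D modulo v; together with the copies of v this represents T, a
-- contradiction.  The only exceptions are v = 3 and bs = (1 , 1) or (1 , 2), treated by hand.
--
-- Lower bound.  The form (1 , 1 , 3 , ... , 3), or (1 , 2 , 3 , ... , 3) if m ≡ 2 modulo 3, is a
-- leaf of the required rank: its proper prefixes miss a number just below 3 q for a reason modulo 3.

open import Defs
open import Data.Bool using (Bool; true; false; _∧_; _∨_; if_then_else_; T)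
open import Data.Empty using (⊥; ⊥-elim)
open import Data.Integer as ℤ using (ℤ; +_; -[1+_])
open import Data.Integer.DivMod using (div-pos-is-/ℕ) renaming (_/_ to _div_)
import Data.Integer.Properties as ℤ
import Data.Integer.Tactic.RingSolver as ℤSolver
open import Data.List using (List; []; _∷_; _∷ʳ_; _++_; length; replicate)
open import Data.List.Properties using (++-assoc; ++-identityʳ; length-++; length-replicate)
open import Data.List.Relation.Binary.Permutation.Propositional as Perm using (_↭_; ↭-sym; ↭-trans; ↭-refl)
import Data.List.Relation.Binary.Permutation.Propositional.Properties as Perm
open import Data.List.Relation.Unary.All as All using (All; []; _∷_)
import Data.List.Relation.Unary.All.Properties as All
open import Data.List.Relation.Unary.Linked using (Linked; []; [-]; _∷_)
open import Data.Nat
open import Data.Nat.DivMod using (m*n/n≡m; m≡m%n+[m/n]*n; m%n<n; m/n*n≤m; [m+n]%n≡m%n; [m+kn]%n≡m%n; m*n%n≡0)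
open import Data.Nat.Induction using (<-rec)
open import Data.Nat.ListAction using (sum)
open import Data.Nat.ListAction.Properties using (sum-++; sum-↭)
open import Data.Nat.Properties
open import Data.Nat.Tactic.RingSolver using (solve-∀)
open import Data.Product using (∃; ∃₂; Σ; _×_; _,_; proj₁; proj₂)
open import Data.Rational.Unnormalised as ℚᵘ using (ℚᵘ; mkℚᵘ)
open import Data.Sum as Sum using (_⊎_; inj₁; inj₂; [_,_]′)
open import Data.Unit using (tt)
open import Function using (_∘_; case_of_)
open import Relation.Binary.PropositionalEquality
open import Relation.Nullary
open import Relation.Nullary.Decidable using (map′; _×-dec_; _⊎-dec_; from-yes; from-no)

-- Values of a form

tri : ℕ → ℕ
tri zero    = 0
tri (suc n) = suc n + tri n

-- With M = m - 2 one has P_m(x) = M x(x-1)/2 + x = (m - 3) t⁻ x + t⁺ x,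
-- where t⁻ x = x(x-1)/2 and t⁺ x = x(x+1)/2 are both natural numbers.
t⁻ t⁺ : ℤ → ℕ
t⁻ (+ zero)    = 0
t⁻ (+ suc n)   = tri n
t⁻ -[1+ n ]    = tri (suc n)
t⁺ (+ n)       = tri n
t⁺ -[1+ n ]    = tri n

2tri : ∀ n → + tri n ℤ.* + 2 ≡ + n ℤ.* (+ n ℤ.+ + 1)
2tri zero = refl
2tri (suc n) = begin
  (+ suc n ℤ.+ + tri n) ℤ.* + 2         ≡⟨ ℤ.*-distribʳ-+ (+ 2) (+ suc n) (+ tri n) ⟩
  + suc n ℤ.* + 2 ℤ.+ + tri n ℤ.* + 2   ≡⟨ cong (λ z → + suc n ℤ.* + 2 ℤ.+ z) (2tri n) ⟩
  (+ 1 ℤ.+ + n) ℤ.* + 2 ℤ.+ + n ℤ.* (+ n ℤ.+ + 1) ≡⟨ lem (+ n) ⟩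
  (+ 1 ℤ.+ + n) ℤ.* (+ 1 ℤ.+ + n ℤ.+ + 1) ∎
  where
  open ≡-Reasoning
  lem : ∀ x → (+ 1 ℤ.+ x) ℤ.* + 2 ℤ.+ x ℤ.* (x ℤ.+ + 1) ≡ (+ 1 ℤ.+ x) ℤ.* (+ 1 ℤ.+ x ℤ.+ + 1)
  lem = ℤSolver.solve-∀

2t⁻ : ∀ x → + t⁻ x ℤ.* + 2 ≡ x ℤ.* (x ℤ.- + 1)
2t⁻ (+ zero)  = refl
2t⁻ (+ suc n) = trans (2tri n) (lem (+ n))
  where
  lem : ∀ x → x ℤ.* (x ℤ.+ + 1) ≡ (+ 1 ℤ.+ x) ℤ.* (+ 1 ℤ.+ x ℤ.- + 1)
  lem = ℤSolver.solve-∀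
2t⁻ -[1+ n ]  = trans (2tri (suc n)) (lem (+ n))
  where
  lem : ∀ x → (+ 1 ℤ.+ x) ℤ.* (+ 1 ℤ.+ x ℤ.+ + 1) ≡ (ℤ.- (+ 1 ℤ.+ x)) ℤ.* (ℤ.- (+ 1 ℤ.+ x) ℤ.- + 1)
  lem = ℤSolver.solve-∀

2t⁺ : ∀ x → + t⁺ x ℤ.* + 2 ≡ x ℤ.* (x ℤ.+ + 1)
2t⁺ (+ n)     = 2tri n
2t⁺ -[1+ n ]  = trans (2tri n) (lem (+ n))
  where
  lem : ∀ x → x ℤ.* (x ℤ.+ + 1) ≡ (ℤ.- (+ 1 ℤ.+ x)) ℤ.* (ℤ.- (+ 1 ℤ.+ x) ℤ.+ + 1)
  lem = ℤSolver.solve-∀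

P-split : ∀ q x → P (3 + q) x ≡ + (q * t⁻ x + t⁺ x)
P-split q x = begin
  (((+ 3 ℤ.+ + q) ℤ.- + 2) ℤ.* x ℤ.* x ℤ.- ((+ 3 ℤ.+ + q) ℤ.- + 4) ℤ.* x) div + 2
    ≡⟨ cong (_div + 2) (lem (+ q) x) ⟩
  (+ q ℤ.* (x ℤ.* (x ℤ.- + 1)) ℤ.+ x ℤ.* (x ℤ.+ + 1)) div + 2
    ≡⟨ cong₂ (λ y z → (+ q ℤ.* y ℤ.+ z) div + 2) (sym (2t⁻ x)) (sym (2t⁺ x)) ⟩
  (+ q ℤ.* (+ t⁻ x ℤ.* + 2) ℤ.+ + t⁺ x ℤ.* + 2) div + 2
    ≡⟨ cong (_div + 2) (lem₂ (+ q) (+ t⁻ x) (+ t⁺ x)) ⟩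
  ((+ q ℤ.* + t⁻ x ℤ.+ + t⁺ x) ℤ.* + 2) div + 2
    ≡⟨ cong (λ z → ((z ℤ.+ + t⁺ x) ℤ.* + 2) div + 2) (sym (ℤ.pos-* q (t⁻ x))) ⟩
  (+ N ℤ.* + 2) div + 2
    ≡⟨ cong (_div + 2) (sym (ℤ.pos-* N 2)) ⟩
  + (N * 2) div + 2
    ≡⟨ div-pos-is-/ℕ (+ (N * 2)) 2 ⟩
  + (N * 2 / 2)
    ≡⟨ cong +_ (m*n/n≡m N 2) ⟩
  + N ∎
  where
  open ≡-Reasoning
  N = q * t⁻ x + t⁺ x
  lem : ∀ q x → ((+ 3 ℤ.+ q) ℤ.- + 2) ℤ.* x ℤ.* x ℤ.- ((+ 3 ℤ.+ q) ℤ.- + 4) ℤ.* x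
              ≡ q ℤ.* (x ℤ.* (x ℤ.- + 1)) ℤ.+ x ℤ.* (x ℤ.+ + 1)
  lem = ℤSolver.solve-∀
  lem₂ : ∀ q a b → q ℤ.* (a ℤ.* + 2) ℤ.+ b ℤ.* + 2 ≡ (q ℤ.* a ℤ.+ b) ℤ.* + 2
  lem₂ = ℤSolver.solve-∀

-- Keeps `A` and `D` apart and does not mention `q`, so that exchanges can alter one part alone and
-- one finite table serves every `q`.
data Rep : List ℕ → ℕ → ℕ → Set where
  nil  : Rep [] 0 0
  cons : ∀ {a as A D A′ D′} x → a * t⁻ x + A ≡ A′ → a * t⁺ x + D ≡ D′ →
         Rep as A D → Rep (a ∷ as) A′ D′

Rep-zeros : ∀ as → Rep as 0 0
Rep-zeros [] = nil
Rep-zeros (a ∷ as) = cons (+ 0) (lem a) (lem a) (Rep-zeros as)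
  where
  lem : ∀ a → a * 0 + 0 ≡ 0
  lem = solve-∀

record Val (q : ℕ) (as : List ℕ) (N : ℕ) : Set where
  constructor val
  field
    {A D} : ℕ
    rep   : Rep as A D
    total : q * A + D ≡ N

eval-∷ : ∀ q a as x xs {A D} → eval (3 + q) as xs ≡ + (q * A + D) →
         eval (3 + q) (a ∷ as) (x ∷ xs) ≡ + (q * (a * t⁻ x + A) + (a * t⁺ x + D))
eval-∷ q a as x xs {A} {D} eq = begin
  + a ℤ.* P (3 + q) x ℤ.+ eval (3 + q) as xs  ≡⟨ cong₂ (λ y z → + a ℤ.* y ℤ.+ z) (P-split q x) eq ⟩
  + a ℤ.* + p ℤ.+ + (q * A + D)               ≡⟨ cong (ℤ._+ + (q * A + D)) (sym (ℤ.pos-* a p)) ⟩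
  + (a * p + (q * A + D))                     ≡⟨ cong +_ (lem a (t⁻ x) (t⁺ x) q A D) ⟩
  + (q * (a * t⁻ x + A) + (a * t⁺ x + D)) ∎
  where
  open ≡-Reasoning
  p = q * t⁻ x + t⁺ x
  lem : ∀ a s t q A D → a * (q * s + t) + (q * A + D) ≡ q * (a * s + A) + (a * t + D)
  lem = solve-∀

Rep⇒Represents : ∀ q {as A D} → Rep as A D → Represents (3 + q) as (q * A + D)
Rep⇒Represents q nil = [] , refl , cong +_ (sym (trans (+-identityʳ _) (*-zeroʳ q)))
Rep⇒Represents q {a ∷ as} (cons x refl refl r) with Rep⇒Represents q r
... | xs , len , eq = x ∷ xs , cong suc len , eval-∷ q a as x xs eq

eval⇒Rep : ∀ q as xs → length xs ≡ length as →
           ∃₂ λ A D → Rep as A D × eval (3 + q) as xs ≡ + (q * A + D)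
eval⇒Rep q [] [] _ = 0 , 0 , nil , cong +_ (sym (trans (+-identityʳ _) (*-zeroʳ q)))
eval⇒Rep q (a ∷ as) (x ∷ xs) len with eval⇒Rep q as xs (suc-injective len)
... | A , D , r , eq = _ , _ , cons x refl refl r , eval-∷ q a as x xs eq

Val⇒Represents : ∀ q as N → Val q as N → Represents (3 + q) as N
Val⇒Represents q as _ (val r refl) = Rep⇒Represents q r

Represents⇒Val : ∀ q as N → Represents (3 + q) as N → Val q as N
Represents⇒Val q as N (xs , len , eq) with eval⇒Rep q as xs len
... | A , D , r , eq′ = val r (ℤ.+-injective (trans (sym eq′) eq))

record Truant (q : ℕ) (as : List ℕ) (T : ℕ) : Set where
  field
    positive : 1 ≤ T
    missed   : ¬ Val q as T
    reached  : ∀ {N} → N < T → Val q as N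

open Truant public

Val-zero : ∀ {q as} → Val q as 0
Val-zero {q} {as} = val (Rep-zeros as) (trans (+-identityʳ _) (*-zeroʳ q))

IsTruant⇒Truant : ∀ q as T → IsTruant (3 + q) as T → Truant q as T
IsTruant⇒Truant q as T (1≤T , ¬rep , below) = record
  { positive = 1≤T
  ; missed   = λ v → ¬rep (Val⇒Represents q as T v)
  ; reached  = λ { {zero} _ → Val-zero ; {suc N} N<T → Represents⇒Val q as (suc N) (below (suc N) (s≤s z≤n) N<T) }
  }

Truant⇒IsTruant : ∀ q as T → Truant q as T → IsTruant (3 + q) as T
Truant⇒IsTruant q as T t =
  positive t , (λ r → missed t (Represents⇒Val q as T r)) , λ k _ k<T → Val⇒Represents q as k (reached t k<T)

-- Deduces a linear inequality from another one; the equation is left to the ring solver.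
by-≤ : ∀ {a b x y} d → a ≤ b → x + b + d ≡ y + a → x ≤ y
by-≤ {a} {b} {x} {y} d a≤b eq = +-cancelʳ-≤ b x y (begin
  x + b     ≤⟨ m≤m+n (x + b) d ⟩
  x + b + d ≡⟨ eq ⟩
  y + a     ≤⟨ +-monoʳ-≤ y a≤b ⟩
  y + b     ∎)
  where open ≤-Reasoning

swap-+ : ∀ u v w → u + (v + w) ≡ v + (u + w)
swap-+ = solve-∀

Rep-resp-↭ : ∀ {as bs A D} → as ↭ bs → Rep as A D → Rep bs A D
Rep-resp-↭ Perm.refl r = r
Rep-resp-↭ (Perm.prep a p) (cons x e e′ r) = cons x e e′ (Rep-resp-↭ p r)
Rep-resp-↭ (Perm.swap a b p) (cons x refl refl (cons y refl refl r)) =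
  cons y (swap-+ (b * t⁻ y) (a * t⁻ x) _) (swap-+ (b * t⁺ y) (a * t⁺ x) _)
    (cons x refl refl (Rep-resp-↭ p r))
Rep-resp-↭ (Perm.trans p p′) r = Rep-resp-↭ p′ (Rep-resp-↭ p r)

Rep-++ : ∀ {as bs A D A′ D′} → Rep as A D → Rep bs A′ D′ → Rep (as ++ bs) (A + A′) (D + D′)
Rep-++ nil s = s
Rep-++ {a ∷ _} (cons x refl refl r) s =
  cons x (sym (+-assoc (a * t⁻ x) _ _)) (sym (+-assoc (a * t⁺ x) _ _)) (Rep-++ r s)

Rep-++⁻ : ∀ as {bs A D} → Rep (as ++ bs) A D →
  ∃₂ λ A₁ D₁ → ∃₂ λ A₂ D₂ → Rep as A₁ D₁ × Rep bs A₂ D₂ × A₁ + A₂ ≡ A × D₁ + D₂ ≡ D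
Rep-++⁻ [] r = 0 , 0 , _ , _ , nil , r , refl , refl
Rep-++⁻ (a ∷ as) (cons x refl refl r) with Rep-++⁻ as r
... | _ , _ , _ , _ , r₁ , r₂ , refl , refl =
  _ , _ , _ , _ , cons x refl refl r₁ , r₂ , +-assoc (a * t⁻ x) _ _ , +-assoc (a * t⁺ x) _ _

Rep-ones : ∀ as → Rep as 0 (sum as)
Rep-ones [] = nil
Rep-ones (a ∷ as) = cons (+ 1) (lem a) (lem₂ a (sum as)) (Rep-ones as)
  where
  lem : ∀ a → a * 0 + 0 ≡ 0
  lem = solve-∀
  lem₂ : ∀ a s → a * 1 + s ≡ a + s
  lem₂ = solve-∀

Rep-multiple : ∀ v {j L} → j ≤ L → Rep (replicate L v) 0 (j * v)
Rep-multiple v {L = L} z≤n = Rep-zeros (replicate L v)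
Rep-multiple v {suc j} (s≤s j≤L) = cons (+ 1) (lem v) (lem₂ v (j * v)) (Rep-multiple v j≤L)
  where
  lem : ∀ a → a * 0 + 0 ≡ 0
  lem = solve-∀
  lem₂ : ∀ a s → a * 1 + s ≡ a + s
  lem₂ = solve-∀

n≤tri : ∀ n → n ≤ tri n
n≤tri zero    = z≤n
n≤tri (suc n) = m≤m+n (suc n) (tri n)

t⁺≤2t⁻+1 : ∀ x → t⁺ x ≤ 2 * t⁻ x + 1
t⁺≤2t⁻+1 (+ zero)  = z≤n
t⁺≤2t⁻+1 (+ suc n) = by-≤ 0 (n≤tri n) (lem n (tri n))
  where
  lem : ∀ n t → suc n + t + t + 0 ≡ 2 * t + 1 + n
  lem = solve-∀
t⁺≤2t⁻+1 -[1+ n ]  = by-≤ (n + tri n + n + 3) (z≤n {0}) (lem n (tri n))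
  where
  lem : ∀ n t → t + 0 + (n + t + n + 3) ≡ 2 * (suc n + t) + 1 + 0
  lem = solve-∀

-- Sums `t⁺ ≤ 2 t⁻ + 1`. At `A = 0` it caps the value by the sum of the coefficients; for small `A`
-- it caps the representatives of residues in `fill`.
Rep-bound : ∀ {as A D} → Rep as A D → D ≤ 2 * A + sum as
Rep-bound nil = z≤n
Rep-bound {a ∷ as} (cons {A = A} {D = D} x refl refl r) = begin
  a * t⁺ x + D                               ≤⟨ +-mono-≤ (*-monoʳ-≤ a (t⁺≤2t⁻+1 x)) (Rep-bound r) ⟩
  a * (2 * t⁻ x + 1) + (2 * A + sum as)      ≡⟨ lem a (t⁻ x) A (sum as) ⟩
  2 * (a * t⁻ x + A) + (a + sum as)          ∎
  where
  open ≤-Reasoning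
  lem : ∀ a t A s → a * (2 * t + 1) + (2 * A + s) ≡ 2 * (a * t + A) + (a + s)
  lem = solve-∀

Val-++ˡ : ∀ {q as N} bs → Val q as N → Val q (as ++ bs) N
Val-++ˡ {q} bs (val {A} {D} r refl) =
  val (Rep-++ r (Rep-zeros bs)) (cong₂ (λ y z → q * y + z) (+-identityʳ A) (+-identityʳ D))

Val-∷ʳ : ∀ {q as N a} → Val q as N → Val q (as ∷ʳ a) (a + N)
Val-∷ʳ {q} {a = a} (val {A} {D} r refl) = val (Rep-++ r (Rep-ones (a ∷ []))) (lem q A D a)
  where
  lem : ∀ q A D a → q * (A + 0) + (D + (a + 0)) ≡ a + (q * A + D)
  lem = solve-∀

-- Deciding whether a number is represented

value : ℕ → ℤ → ℕ
value q x = q * t⁻ x + t⁺ x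

∣x∣≤value : ∀ q n → 1 ≤ q → n ≤ value q (+ n) × suc n ≤ value q -[1+ n ]
∣x∣≤value q n 1≤q =
  ≤-trans (n≤tri n) (m≤n+m (tri n) (q * t⁻ (+ n))) ,
  ≤-trans (≤-trans (n≤tri (suc n)) (m≤n*m (tri (suc n)) q ⦃ >-nonZero 1≤q ⦄))
          (m≤m+n (q * tri (suc n)) (tri n))

-- As `q` and the coefficients are positive, a variable contributes at least its absolute value, so
-- only finitely many values need trying.
Val? : ∀ q → 1 ≤ q → ∀ as → All (1 ≤_) as → ∀ N → Dec (Val q as N)
Val? q 1≤q [] _ N = map′ to from (0 ≟ N)
  where
  to : 0 ≡ N → Val q [] N
  to refl = Val-zero
  from : Val q [] N → 0 ≡ N
  from (val nil refl) = sym (trans (+-identityʳ _) (*-zeroʳ q))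
Val? q 1≤q (a ∷ as) (1≤a ∷ 1≤as) N =
  map′ to from (anyUpTo? (λ n → try? (+ n) ⊎-dec try? -[1+ n ]) (suc N))
  where
  Try : ℤ → Set
  Try x = a * value q x ≤ N × Val q as (N ∸ a * value q x)
  try? : ∀ x → Dec (Try x)
  try? x = (a * value q x ≤? N) ×-dec Val? q 1≤q as 1≤as (N ∸ a * value q x)
  lem : ∀ a s t q A D → q * (a * s + A) + (a * t + D) ≡ a * (q * s + t) + (q * A + D)
  lem = solve-∀
  found : ∀ x → Try x → Val q (a ∷ as) N
  found x (≤N , val {A} {D} r eq) = val (cons x refl refl r)
    (trans (lem a (t⁻ x) (t⁺ x) q A D) (trans (cong (λ z → a * value q x + z) eq) (m+[n∸m]≡n ≤N)))
  to : (∃ λ n → n < suc N × (Try (+ n) ⊎ Try -[1+ n ])) → Val q (a ∷ as) N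
  to (n , _ , inj₁ t) = found (+ n) t
  to (n , _ , inj₂ t) = found -[1+ n ] t
  from : Val q (a ∷ as) N → ∃ λ n → n < suc N × (Try (+ n) ⊎ Try -[1+ n ])
  from (val (cons {A = A} {D = D} x refl refl r) refl) = go x r
    where
    tried : ∀ x → Rep as A D → let N = q * (a * t⁻ x + A) + (a * t⁺ x + D) in
            value q x ≤ N × a * value q x ≤ N × Val q as (N ∸ a * value q x)
    tried x r rewrite lem a (t⁻ x) (t⁺ x) q A D =
      ≤-trans (m≤n*m (value q x) a ⦃ >-nonZero 1≤a ⦄) (m≤m+n _ _) , m≤m+n _ _ ,
      val r (sym (m+n∸m≡n (a * value q x) (q * A + D)))
    go : ∀ x → Rep as A D → let N = q * (a * t⁻ x + A) + (a * t⁺ x + D) in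
         ∃ λ n → n < suc N × ((a * value q (+ n) ≤ N × Val q as (N ∸ a * value q (+ n)))
                           ⊎ (a * value q -[1+ n ] ≤ N × Val q as (N ∸ a * value q -[1+ n ])))
    go (+ n) r with tried (+ n) r
    ... | p , t = n , s≤s (≤-trans (proj₁ (∣x∣≤value q n 1≤q)) p) , inj₁ t
    go -[1+ n ] r with tried -[1+ n ] r
    ... | p , t = n , s≤s (≤-trans (n≤1+n n) (≤-trans (proj₂ (∣x∣≤value q n 1≤q)) p)) , inj₂ t

-- Exchanges among equal coefficients

Rep-prepend-ones : ∀ v c {r A D} → Rep (replicate r v) A D → Rep (replicate (c + r) v) A (c * v + D)
Rep-prepend-ones v zero r = r
Rep-prepend-ones v (suc c) {D = D} r = cons (+ 1) (lem v _) (lem₂ v (c * v) D) (Rep-prepend-ones v c r)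
  where
  lem : ∀ v A → v * 0 + A ≡ A
  lem = solve-∀
  lem₂ : ∀ v w D → v * 1 + (w + D) ≡ v + w + D
  lem₂ = solve-∀

-- A variable other than 0 and 1 takes at least 1 from `A`, so passing over it keeps the surplus of
-- three variables over `A`.
drop-one : ∀ v c r t A → 1 ≤ v → 1 ≤ t → v * t + A + 3 ≤ c + suc r → A + 3 ≤ c + r
drop-one v c r t A 1≤v 1≤t le = s≤s⁻¹ (begin
  1 + (A + 3)    ≤⟨ +-monoˡ-≤ (A + 3) (*-mono-≤ 1≤v 1≤t) ⟩
  v * t + (A + 3) ≡⟨ +-assoc (v * t) A 3 ⟨
  v * t + A + 3  ≤⟨ le ⟩
  c + suc r      ≡⟨ +-suc c r ⟩
  suc (c + r)    ∎)
  where open ≤-Reasoning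

-- Among the r + c copies of v, at least three of the variables are 0 or 1.  Either change
-- some x = 0 to x = -1, or change (1 , 1 , 1) to (2 , 0 , 0); here c counts the ones set aside.
shift-replicate : ∀ v → 1 ≤ v → ∀ c r {A D} → c ≤ 2 → A + 3 ≤ c + r →
  Rep (replicate r v) A D → Rep (replicate (c + r) v) (v + A) (c * v + D)
shift-replicate v 1≤v c zero c≤2 A+3≤c nil =
  contradiction (≤-trans A+3≤c (subst (_≤ 2) (sym (+-identityʳ c)) c≤2)) λ { (s≤s (s≤s ())) }
shift-replicate v 1≤v c (suc r) c≤2 le (cons {A = A} {D = D} (+ 0) refl refl rep) =
  Rep-prepend-ones v c (cons -[1+ 0 ] (lem v A) refl rep)
  where
  lem : ∀ v A → v * 1 + A ≡ v + (v * 0 + A)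
  lem = solve-∀
shift-replicate v 1≤v 2 (suc r) c≤2 le (cons {A = A} {D = D} (+ 1) refl refl rep) =
  cons (+ 2) (lem v A) (lem₂ v D) (cons (+ 0) refl refl (cons (+ 0) refl refl rep))
  where
  lem : ∀ v A → v * 1 + (v * 0 + (v * 0 + A)) ≡ v + (v * 0 + A)
  lem = solve-∀
  lem₂ : ∀ v D → v * 3 + (v * 0 + (v * 0 + D)) ≡ 2 * v + (v * 1 + D)
  lem₂ = solve-∀
shift-replicate v 1≤v (suc (suc (suc _))) (suc r) (s≤s (s≤s ())) le (cons (+ 1) _ _ rep)
shift-replicate v 1≤v 0 (suc r) c≤2 le (cons {A = A} {D = D} (+ 1) refl refl rep) =
  subst₂ (Rep (v ∷ replicate r v)) (lem v A) (lem₂ v D)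
    (shift-replicate v 1≤v 1 r (s≤s z≤n) (subst (λ A → A + 3 ≤ suc r) (lem₃ v A) le) rep)
  where
  lem : ∀ v A → v + A ≡ v + (v * 0 + A)
  lem = solve-∀
  lem₂ : ∀ v D → 1 * v + D ≡ 0 * v + (v * 1 + D)
  lem₂ = solve-∀
  lem₃ : ∀ v A → v * 0 + A ≡ A
  lem₃ = solve-∀
shift-replicate v 1≤v 1 (suc r) c≤2 le (cons {A = A} {D = D} (+ 1) refl refl rep) =
  subst₂ (Rep (v ∷ v ∷ replicate r v)) (lem v A) (lem₂ v D)
    (shift-replicate v 1≤v 2 r (s≤s (s≤s z≤n)) (subst (λ A → A + 3 ≤ 2 + r) (lem₃ v A) le) rep)
  where
  lem : ∀ v A → v + A ≡ v + (v * 0 + A)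
  lem = solve-∀
  lem₂ : ∀ v D → 2 * v + D ≡ 1 * v + (v * 1 + D)
  lem₂ = solve-∀
  lem₃ : ∀ v A → v * 0 + A ≡ A
  lem₃ = solve-∀
shift-replicate v 1≤v c (suc r) c≤2 le (cons {A = A} {D = D} x@(+ suc (suc n)) refl refl rep) =
  subst (λ k → Rep (replicate k v) (v + (v * t⁻ x + A)) (c * v + (v * t⁺ x + D))) (sym (+-suc c r))
    (cons x (swap-+ (v * t⁻ x) v A) (swap-+ (v * t⁺ x) (c * v) D)
      (shift-replicate v 1≤v c r c≤2 (drop-one v c r (t⁻ x) A 1≤v (s≤s z≤n) le) rep))
shift-replicate v 1≤v c (suc r) c≤2 le (cons {A = A} {D = D} x@(-[1+ n ]) refl refl rep) =
  subst (λ k → Rep (replicate k v) (v + (v * t⁻ x + A)) (c * v + (v * t⁺ x + D))) (sym (+-suc c r))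
    (cons x (swap-+ (v * t⁻ x) v A) (swap-+ (v * t⁺ x) (c * v) D)
      (shift-replicate v 1≤v c r c≤2 (drop-one v c r (t⁻ x) A 1≤v (s≤s z≤n) le) rep))

shift : ∀ {v} → 1 ≤ v → ∀ bs L es {A D} → A + 3 ≤ L →
  Rep (bs ++ replicate L v ++ es) A D → Rep (bs ++ replicate L v ++ es) (v + A) D
shift {v} 1≤v bs L es le r with Rep-++⁻ bs r
... | A₁ , D₁ , _ , _ , r₁ , r₂₃ , refl , refl with Rep-++⁻ (replicate L v) r₂₃
... | A₂ , D₂ , A₃ , D₃ , r₂ , r₃ , refl , refl =
  subst (λ A → Rep (bs ++ replicate L v ++ es) A (D₁ + (D₂ + D₃))) (lem v A₁ A₂ A₃)
    (Rep-++ r₁ (Rep-++ (shift-replicate v 1≤v 0 L z≤n (≤-trans (+-monoˡ-≤ 3 A₂≤A) le) r₂) r₃))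
  where
  A₂≤A : A₂ ≤ A₁ + (A₂ + A₃)
  A₂≤A = ≤-trans (m≤m+n A₂ A₃) (m≤n+m (A₂ + A₃) A₁)
  lem : ∀ v a b c → a + (v + b + c) ≡ v + (a + (b + c))
  lem = solve-∀

-- Nodes and truants

sum-∷ʳ : ∀ as a → sum (as ∷ʳ a) ≡ a + sum as
sum-∷ʳ as a = trans (sum-++ as (a ∷ [])) (lem (sum as) a)
  where
  lem : ∀ s a → s + (a + 0) ≡ a + s
  lem = solve-∀

1≤value : ∀ {q} → 1 ≤ q → ∀ x → x ≢ + 0 → 1 ≤ value q x
1≤value 1≤q (+ zero)  x≢0 = contradiction refl x≢0
1≤value 1≤q (+ suc n) x≢0 = ≤-trans (s≤s z≤n) (proj₁ (∣x∣≤value _ (suc n) 1≤q))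
1≤value 1≤q -[1+ n ]  x≢0 = ≤-trans (s≤s z≤n) (proj₂ (∣x∣≤value _ n 1≤q))

-- Without the new variable `T` is missed, so that variable is nonzero and contributes at least `a`.
new-coefficient-≤ : ∀ {q as a T} → 1 ≤ q → ¬ Val q as T → Val q (as ∷ʳ a) T → a ≤ T
new-coefficient-≤ {q} {as} {a} 1≤q ¬T (val r refl) with Rep-++⁻ as r
... | A , D , _ , _ , r₁ , cons x refl refl nil , refl , refl with x ℤ.≟ + 0
... | yes refl = contradiction (val r₁ (lem q A D a)) ¬T
  where
  lem : ∀ q A D a → q * A + D ≡ q * (A + (a * 0 + 0)) + (D + (a * 0 + 0))
  lem = solve-∀
... | no x≢0 = begin
  a                 ≤⟨ m≤m*n a (value q x) ⦃ >-nonZero (1≤value 1≤q x x≢0) ⦄ ⟩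
  a * value q x     ≤⟨ m≤n+m _ (q * A + D) ⟩
  q * A + D + a * value q x ≡⟨ lem q A D a (t⁻ x) (t⁺ x) ⟩
  q * (A + (a * t⁻ x + 0)) + (D + (a * t⁺ x + 0)) ∎
  where
  open ≤-Reasoning
  lem : ∀ q A D a s t → q * A + D + a * (q * s + t) ≡ q * (A + (a * s + 0)) + (D + (a * t + 0))
  lem = solve-∀

-- If `T ≤ T′ < a + T`, the old form represents `T′ - a`, and setting the new variable to 1 reaches
-- `T′`. By induction truants outgrow the sums of the coefficients.
child-truant : ∀ {q as a T T′} → 1 ≤ q → Truant q as T → Val q (as ∷ʳ a) T →
               Truant q (as ∷ʳ a) T′ → a + T ≤ T′
child-truant {q} {as} {a} {T} {T′} 1≤q truant rep truant′ with T′ <? T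
... | yes T′<T = contradiction (Val-++ˡ (a ∷ []) (reached truant T′<T)) (missed truant′)
... | no T′≮T = ≮⇒≥ λ T′<a+T → missed truant′
    (subst (Val q (as ∷ʳ a)) (m+[n∸m]≡n a≤T′)
      (Val-∷ʳ (reached truant (subst (T′ ∸ a <_) (m+n∸m≡n a T) (∸-monoˡ-< T′<a+T a≤T′)))))
  where
  a≤T′ : a ≤ T′
  a≤T′ = ≤-trans (new-coefficient-≤ 1≤q (missed truant) rep) (≮⇒≥ T′≮T)

sum<truant : ∀ {q as T} → 1 ≤ q → Node (3 + q) as → Truant q as T → sum as < T
sum<truant 1≤q root truant = positive truant
sum<truant {q} {T = T} 1≤q (child {as} a T₀ node truant₀ _ rep) truant = begin-strict
  sum (as ∷ʳ a)  ≡⟨ sum-∷ʳ as a ⟩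
  a + sum as     <⟨ +-monoʳ-< a (sum<truant 1≤q node (IsTruant⇒Truant q as T₀ truant₀)) ⟩
  a + T₀         ≤⟨ child-truant 1≤q (IsTruant⇒Truant q as T₀ truant₀) (Represents⇒Val q (as ∷ʳ a) T₀ rep) truant ⟩
  T              ∎
  where open ≤-Reasoning

truant≤1+sum : ∀ {q as T} → Truant q as T → suc (sum as) < q → T ≤ suc (sum as)
truant≤1+sum {q} {as} {T} truant s<q = ≮⇒≥ λ s<T → small (reached truant s<T)
  where
  small : ¬ Val q as (suc (sum as))
  small (val {zero} {D} r eq) =
    1+n≰n (subst (_≤ sum as) (trans (cong (_+ D) (sym (*-zeroʳ q))) eq) (Rep-bound r))
  small (val {suc A} {D} r eq) =
    <⇒≱ s<q (subst (q ≤_) eq (≤-trans (m≤m*n q (suc A)) (m≤m+n _ D)))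

-- A list that continues one with last coefficient lo and sum s.  While s + 1 < q, the truant is
-- s + 1, because every value with A ≥ 1 is at least q; this bounds the next coefficient.
data Chain (q : ℕ) : ℕ → ℕ → List ℕ → Set where
  []   : ∀ {lo s} → Chain q lo s []
  link : ∀ {lo s a as} → lo ≤ a → (suc s < q → a ≤ suc s) → Chain q a (s + a) as → Chain q lo s (a ∷ as)

last-or : ℕ → List ℕ → ℕ
last-or lo []       = lo
last-or lo (a ∷ as) = last-or a as

LastBound≡last-or : ∀ as → LastBound as ≡ last-or 1 as
LastBound≡last-or []           = refl
LastBound≡last-or (a ∷ [])     = refl
LastBound≡last-or (a ∷ b ∷ as) = LastBound≡last-or (b ∷ as)

Chain-++ : ∀ {q lo s} as {bs} → Chain q lo s as → Chain q (last-or lo as) (s + sum as) bs → Chain q lo s (as ++ bs)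
Chain-++ {q} {lo} {s} [] {bs} [] c = subst (λ s → Chain q lo s bs) (+-identityʳ s) c
Chain-++ {q} {lo} {s} (a ∷ as) {bs} (link p f c) c′ =
  link p f (Chain-++ as c (subst (λ s → Chain q (last-or a as) s bs) (sym (+-assoc s a (sum as))) c′))

Chain-++⁻ : ∀ {q lo s} as {bs} → Chain q lo s (as ++ bs) → Chain q lo s as × Chain q (last-or lo as) (s + sum as) bs
Chain-++⁻ {q} {lo} {s} [] {bs} c = [] , subst (λ s → Chain q lo s bs) (sym (+-identityʳ s)) c
Chain-++⁻ {q} {lo} {s} (a ∷ as) {bs} (link p f c) with Chain-++⁻ as c
... | c₁ , c₂ = link p f c₁ , subst (λ s → Chain q (last-or a as) s bs) (+-assoc s a (sum as)) c₂

node-chain : ∀ {q as} → 1 ≤ q → Node (3 + q) as → Chain q 1 0 as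
node-chain 1≤q root = []
node-chain {q} 1≤q (child {as} a T node truant lo≤a rep) =
  Chain-++ as (node-chain 1≤q node) (link (subst (_≤ a) (LastBound≡last-or as) lo≤a)
    (λ s<q → ≤-trans (new-coefficient-≤ 1≤q (missed truant′) (Represents⇒Val q (as ∷ʳ a) T rep))
                     (truant≤1+sum truant′ s<q)) [])
  where truant′ = IsTruant⇒Truant q as T truant

Chain-≤ : ∀ {q lo s as} → Chain q lo s as → All (lo ≤_) as
Chain-≤ [] = []
Chain-≤ (link p f c) = p ∷ All.map (≤-trans p) (Chain-≤ c)

Chain-linked : ∀ {q lo s as} → Chain q lo s as → Linked _≤_ as
Chain-linked [] = []
Chain-linked (link p f []) = [-]
Chain-linked (link p f c@(link p′ _ _)) = p′ ∷ Chain-linked c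

Chain⇒IsForm : ∀ {q as} → Chain q 1 0 as → IsForm as
Chain⇒IsForm c = Chain-≤ c , Chain-linked c

-- Locating a coefficient that occurs often

split-equal : ∀ {q v s as} → Chain q v s as →
  ∃₂ λ L es → as ≡ replicate L v ++ es × Chain q (suc v) (s + L * v) es
split-equal {q} {v} {s} [] = 0 , [] , refl , []
split-equal {q} {v} {s} (link {a = a} p f c) with v ≟ a
... | no v≢a = 0 , _ , refl , link (≤∧≢⇒< p v≢a)
        (subst (λ s → suc s < q → a ≤ suc s) (sym (+-identityʳ s)) f)
        (subst (λ s → Chain q a (s + a) _) (sym (+-identityʳ s)) c)
... | yes refl with split-equal c
...   | L , es , refl , c′ = suc L , es , refl , subst (λ s → Chain q (suc v) s es) (+-assoc s v (L * v)) c′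

sum-replicate : ∀ L v → sum (replicate L v) ≡ L * v
sum-replicate zero v = refl
sum-replicate (suc L) v = cong (_+_ v) (sum-replicate L v)

length*lo≤sum : ∀ {lo as} → All (lo ≤_) as → length as * lo ≤ sum as
length*lo≤sum [] = z≤n
length*lo≤sum (p ∷ ps) = +-mono-≤ p (length*lo≤sum ps)

sum≤length*hi : ∀ {hi as} → All (_≤ hi) as → sum as ≤ length as * hi
sum≤length*hi [] = z≤n
sum≤length*hi (p ∷ ps) = +-mono-≤ p (sum≤length*hi ps)

-- The frequent coefficient is `suc u`. The bound `few` reflects that each of the `u` smaller values
-- occurs at most `K + 2` times.
record Split (q : ℕ) (as : List ℕ) (K u : ℕ) : Set where
  field
    {bs es} : List ℕ
    {L}     : ℕ
    shape   : as ≡ bs ++ replicate L (suc u) ++ es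
    below   : All (_≤ u) bs
    above   : All (suc (suc u) ≤_) es
    few     : length bs ≤ u * (K + 2)
    many    : K + 3 ≤ L

-- Tries the values 1 to `K` in turn. If none is frequent, all but `K (K + 2)` coefficients are at
-- least `K + 1`, which makes the sum of a long node too large for its truant.
find-split : ∀ {q} K bs rest fuel u → Chain q 1 0 (bs ++ rest) → fuel + u ≡ K →
  All (_≤ u) bs → Chain q (suc u) (sum bs) rest → length bs ≤ u * (K + 2) →
  (∃ λ u → u < K × Split q (bs ++ rest) K u)
  ⊎ length (bs ++ rest) * suc K ≤ K * (K + 2) * suc K + sum (bs ++ rest)
find-split K bs rest zero u chain refl bs≤ c few = inj₂ (begin
  length (bs ++ rest) * suc K                  ≡⟨ cong (_* suc K) (length-++ bs) ⟩
  (length bs + length rest) * suc K            ≡⟨ *-distribʳ-+ (suc K) (length bs) (length rest) ⟩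
  length bs * suc K + length rest * suc K      ≤⟨ +-mono-≤ (*-monoˡ-≤ (suc K) few) (length*lo≤sum (Chain-≤ c)) ⟩
  K * (K + 2) * suc K + sum rest               ≤⟨ +-monoʳ-≤ (K * (K + 2) * suc K) (m≤n+m (sum rest) (sum bs)) ⟩
  K * (K + 2) * suc K + (sum bs + sum rest)    ≡⟨ cong (_+_ (K * (K + 2) * suc K)) (sum-++ bs rest) ⟨
  K * (K + 2) * suc K + sum (bs ++ rest)       ∎)
  where open ≤-Reasoning
find-split {q} K bs rest (suc fuel) u chain eq bs≤ c few with split-equal c
... | L , es , refl , c′ with K + 3 ≤? L
...   | yes many = inj₁ (u , subst (u <_) eq (s≤s (m≤n+m u fuel)) , record
        { shape = refl ; below = bs≤ ; above = Chain-≤ c′ ; few = few ; many = many })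
...   | no ¬many = subst (λ as → (∃ λ u → u < K × Split q as K u)
          ⊎ length as * suc K ≤ K * (K + 2) * suc K + sum as)
          assoc
          (find-split K (bs ++ replicate L (suc u)) es fuel (suc u) (subst (Chain q 1 0) (sym assoc) chain)
            (trans (+-suc fuel u) eq)
            (All.++⁺ (All.map (λ p → ≤-trans p (n≤1+n u)) bs≤) (All.replicate⁺ L ≤-refl))
            (subst (λ s → Chain q (suc (suc u)) s es)
              (sym (trans (sum-++ bs _) (cong (_+_ (sum bs)) (sum-replicate L (suc u))))) c′)
            few′)
  where
  assoc : (bs ++ replicate L (suc u)) ++ es ≡ bs ++ replicate L (suc u) ++ es
  assoc = ++-assoc bs (replicate L (suc u)) es
  few′ : length (bs ++ replicate L (suc u)) ≤ K + 2 + u * (K + 2)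
  few′ = begin
    length (bs ++ replicate L (suc u))  ≡⟨ length-++ bs ⟩
    length bs + length (replicate L (suc u)) ≡⟨ cong (_+_ (length bs)) (length-replicate L) ⟩
    length bs + L                       ≤⟨ +-mono-≤ few (s≤s⁻¹ (subst (suc L ≤_) (+-suc K 2) (≰⇒> ¬many))) ⟩
    u * (K + 2) + (K + 2)               ≡⟨ +-comm (u * (K + 2)) (K + 2) ⟩
    K + 2 + u * (K + 2)                 ∎
    where open ≤-Reasoning

-- Residues attained by the small coefficients

T-split : ∀ {b c} → T (b ∧ c) → T b × T c
T-split {true} t = tt , t

T-case : ∀ {b c} → T (b ∨ c) → T b ⊎ T c
T-case {true}  t = inj₁ tt
T-case {false} t = inj₂ t

allBelow anyBelow : ℕ → (ℕ → Bool) → Bool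
allBelow zero    p = true
allBelow (suc n) p = p n ∧ allBelow n p
anyBelow zero    p = false
anyBelow (suc n) p = p n ∨ anyBelow n p

allBelow-sound : ∀ n p → T (allBelow n p) → ∀ {k} → k < n → T (p k)
allBelow-sound (suc n) p t {k} k<1+n with k ≟ n
... | yes refl = proj₁ (T-split t)
... | no k≢n   = allBelow-sound n p (proj₂ (T-split {p n} t)) (≤∧≢⇒< (s≤s⁻¹ k<1+n) k≢n)

anyBelow-sound : ∀ n p → T (anyBelow n p) → ∃ λ k → k < n × T (p k)
anyBelow-sound (suc n) p t with T-case {p n} t
... | inj₁ u = n , ≤-refl , u
... | inj₂ u with anyBelow-sound n p u
...   | k , k<n , v = k , m≤n⇒m≤1+n k<n , v

Run : List ℕ → ℕ → Set
Run as A = ∀ {i} → i ≤ sum as → Rep as A (A + i)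

-- The new variable at 0 and at 1 gives two translates of the interval, and the bound on `b` leaves
-- no gap between them.
Run-∷ : ∀ {as A b} → b ≤ suc (sum as) → Run as A → Run (b ∷ as) A
Run-∷ {as} {A} {b} b≤ run {i} i≤ with i ≤? sum as
... | yes i≤s = cons (+ 0) (lem b A) (lem b (A + i)) (run i≤s)
  where
  lem : ∀ b A → b * 0 + A ≡ A
  lem = solve-∀
... | no i≰s = cons (+ 1) (lem b A) eq (run (subst (i ∸ b ≤_) (m+n∸m≡n b (sum as)) (∸-monoˡ-≤ b i≤)))
  where
  lem : ∀ b A → b * 0 + A ≡ A
  lem = solve-∀
  lem₂ : ∀ b A i → b * 1 + (A + i) ≡ A + (b + i)
  lem₂ = solve-∀
  eq : b * 1 + (A + (i ∸ b)) ≡ A + i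
  eq = trans (lem₂ b A (i ∸ b)) (cong (_+_ A) (m+[n∸m]≡n (≤-trans b≤ (≰⇒> i≰s))))

bit : List Bool → ℕ → Bool
bit []       _       = false
bit (b ∷ _)  zero    = b
bit (_ ∷ bs) (suc n) = bit bs n

_∪_ : List Bool → List Bool → List Bool
[]       ∪ cs       = cs
bs       ∪ []       = bs
(b ∷ bs) ∪ (c ∷ cs) = (b ∨ c) ∷ (bs ∪ cs)

shiftBits : ℕ → List Bool → List Bool
shiftBits zero    bs = bs
shiftBits (suc k) bs = false ∷ shiftBits k bs

bit-∪ : ∀ bs cs n → T (bit (bs ∪ cs) n) → T (bit bs n) ⊎ T (bit cs n)
bit-∪ []       cs       n       t = inj₂ t
bit-∪ (b ∷ bs) []       n       t = inj₁ t
bit-∪ (b ∷ bs) (c ∷ cs) zero    t = T-case t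
bit-∪ (b ∷ bs) (c ∷ cs) (suc n) t = bit-∪ bs cs n t

bit-shift : ∀ k bs n → T (bit (shiftBits k bs) n) → ∃ λ n′ → k + n′ ≡ n × T (bit bs n′)
bit-shift zero    bs n       t = n , refl , t
bit-shift (suc k) bs (suc n) t with bit-shift k bs n t
... | n′ , eq , t′ = n′ , cong suc eq , t′

level : List (List Bool) → ℕ → List Bool
level []       _       = []
level (l ∷ _)  zero    = l
level (_ ∷ ls) (suc A) = level ls A

-- ls is a table of representations: bit D of level A may be set only if Rep as A D holds.
Sound : List ℕ → List (List Bool) → Set
Sound as ls = ∀ A D → T (bit (level ls A) D) → Rep as A D

move : ℕ → List (List Bool) → ℕ → ℤ → List Bool
move a ls A x = if a * t⁻ x ≤ᵇ A then shiftBits (a * t⁺ x) (level ls (A ∸ a * t⁻ x)) else []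

moves : ℕ → List (List Bool) → ℕ → List ℤ → List Bool
moves a ls A []       = []
moves a ls A (x ∷ xs) = move a ls A x ∪ moves a ls A xs

levels : (ℕ → List Bool) → ℕ → ℕ → List (List Bool)
levels f A zero    = []
levels f A (suc n) = f A ∷ levels f (suc A) n

-- Ten levels and these values of x are enough for the search to succeed.
extend : ℕ → List (List Bool) → List (List Bool)
extend a ls =
  levels (λ A → moves a ls A (+ 0 ∷ + 1 ∷ -[1+ 0 ] ∷ + 2 ∷ -[1+ 1 ] ∷ + 3 ∷ -[1+ 2 ] ∷ + 4 ∷ [])) 0 10

move-sound : ∀ {a as} ls → Sound as ls → ∀ A D x → T (bit (move a ls A x) D) → Rep (a ∷ as) A D
move-sound {a} {as} ls sound A D x t with a * t⁻ x ≤ᵇ A in le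
... | true with bit-shift (a * t⁺ x) (level ls (A ∸ a * t⁻ x)) D t
...   | D′ , eq , t′ = cons x (m+[n∸m]≡n (≤ᵇ⇒≤ (a * t⁻ x) A (subst T (sym le) tt))) eq (sound (A ∸ a * t⁻ x) D′ t′)

moves-sound : ∀ {a as} ls → Sound as ls → ∀ A D xs → T (bit (moves a ls A xs) D) → Rep (a ∷ as) A D
moves-sound {a} {as} ls sound A D (x ∷ xs) t with bit-∪ (move a ls A x) (moves a ls A xs) D t
... | inj₁ u = move-sound ls sound A D x u
... | inj₂ u = moves-sound ls sound A D xs u

level-levels : ∀ f A n k D → T (bit (level (levels f A n) k) D) → T (bit (f (k + A)) D)
level-levels f A (suc n) zero    D t = t
level-levels f A (suc n) (suc k) D t = subst (λ A → T (bit (f A) D)) (+-suc k A) (level-levels f (suc A) n k D t)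

extend-sound : ∀ {a as} ls → Sound as ls → Sound (a ∷ as) (extend a ls)
extend-sound {a} {as} ls sound A D t =
  moves-sound ls sound A D xs (subst (λ A → T (bit (moves a ls A xs) D)) (+-identityʳ A)
    (level-levels (λ A → moves a ls A xs) 0 10 A D t))
  where
  xs = + 0 ∷ + 1 ∷ -[1+ 0 ] ∷ + 2 ∷ -[1+ 1 ] ∷ + 3 ∷ -[1+ 2 ] ∷ + 4 ∷ []

Residues : List ℕ → ℕ → Set
Residues as v = ∃ λ A → 1 ≤ A × A < v × (∀ {t} → t < v → ∃ λ j → Rep as A (t + j * v))

-- For these lists `A = 1` and `A = 2` each miss some residue of `D` modulo 3.
Exceptional : List ℕ → ℕ → Set
Exceptional as v = v ≡ 3 × (as ↭ 1 ∷ 1 ∷ [] ⊎ as ↭ 1 ∷ 2 ∷ [])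

-- The run has at least `v` consecutive members starting at `A < v`, so a residue `t` is met at `t`,
-- or at `t + v` when `t < A`.
Run⇒Residues : ∀ {as A v} → 1 ≤ A → A < v → v ≤ suc (sum as) → Run as A → Residues as v
Run⇒Residues {as} {A} {v} 1≤A A<v v≤ run = A , 1≤A , A<v , found
  where
  found : ∀ {t} → t < v → ∃ λ j → Rep as A (t + j * v)
  found {t} t<v with A ≤? t
  ... | yes A≤t = 0 , subst (Rep as A) (trans (m+[n∸m]≡n A≤t) (sym (+-identityʳ t)))
                        (run (s≤s⁻¹ (≤-trans (s≤s (m∸n≤m t A)) (≤-trans t<v v≤))))
  ... | no A≰t = 1 , subst (Rep as A) (trans (m+[n∸m]≡n A≤t+v) (cong (_+_ t) (sym (+-identityʳ v))))
                       (run (s≤s⁻¹ (≤-trans smaller v≤)))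
    where
    A≤t+v : A ≤ t + v
    A≤t+v = ≤-trans (<⇒≤ A<v) (m≤n+m v t)
    smaller : suc (t + v ∸ A) ≤ v
    smaller = subst (suc (t + v ∸ A) ≤_) (m+n∸m≡n t v) (∸-monoʳ-< (≰⇒> A≰t) A≤t+v)

run? : List (List Bool) → ℕ → ℕ → Bool
run? ls s A = allBelow (suc s) (λ i → bit (level ls A) (A + i))

residues? : List (List Bool) → ℕ → ℕ → Bool
-- Any cutoff for `j` is sound; with 8 the search succeeds.
residues? ls v A = allBelow v (λ t → anyBelow 8 (λ j → bit (level ls A) (t + j * v)))

exceptional? : List ℕ → ℕ → Bool
exceptional? (1 ∷ 1 ∷ []) 3 = true
exceptional? (2 ∷ 1 ∷ []) 3 = true
exceptional? _            _ = false

exceptional?-sound : ∀ as v → T (exceptional? as v) → Exceptional as v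
exceptional?-sound (1 ∷ 1 ∷ []) 3 t = refl , inj₁ ↭-refl
exceptional?-sound (2 ∷ 1 ∷ []) 3 t = refl , inj₂ (Perm.swap 2 1 ↭-refl)

terminal? : List (List Bool) → List ℕ → ℕ → Bool
terminal? ls as v = anyBelow (v ∸ 1) (λ k → residues? ls v (suc k)) ∨ exceptional? as v

terminal?-sound : ∀ {as} ls → Sound as ls → ∀ v → T (terminal? ls as v) → Residues as v ⊎ Exceptional as v
terminal?-sound {as} ls sound v t with T-case {anyBelow (v ∸ 1) (λ k → residues? ls v (suc k))} t
... | inj₂ e = inj₂ (exceptional?-sound as v e)
terminal?-sound {as} ls sound (suc u) t | inj₁ r with anyBelow-sound u (λ k → residues? ls (suc u) (suc k)) r
... | k , k<u , s = inj₁ (suc k , s≤s z≤n , s≤s k<u , λ {t} t<v →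
        let bits = λ t j → bit (level ls (suc k)) (t + j * suc u)
            j , _ , w = anyBelow-sound 8 (bits t) (allBelow-sound (suc u) (λ t → anyBelow 8 (bits t)) s t<v)
        in j , sound (suc k) (t + j * suc u) w)

-- The coefficients are listed in decreasing order, with a the largest and ls their table.  A node
-- is closed if some A ≤ a attains sum + 1 consecutive values of D, a property inherited by all
-- extensions; otherwise every possible v is tested, and then every possible next coefficient.
explore : ℕ → ℕ → List ℕ → List (List Bool) → Bool
explore zero    a as ls = false
explore (suc f) a as ls =
  anyBelow a (λ k → run? ls (a + sum as) (suc k)) ∨
  (allBelow (suc (sum as)) (λ i → terminal? ls (a ∷ as) (suc a + i)) ∧
   allBelow (suc (suc (sum as))) (λ i → explore f (a + i) (a ∷ as) (extend (a + i) ls)))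

table-[1] : List (List Bool)
table-[1] = extend 1 ((true ∷ []) ∷ [])

-- The finite search, carried out by the type checker. Every branch closes before the fuel 8 runs
-- out.
explore-[1] : T (explore 8 1 [] table-[1])
explore-[1] = tt

Run-++ : ∀ {q lo s as A} cs → Chain q lo s cs → s ≡ sum as → suc (s + sum cs) < q → Run as A → Run (cs ++ as) A
Run-++ [] c eq lt run = run
Run-++ {q} {s = s} {as} {A} (b ∷ cs) (link _ f c) refl lt run i≤ =
  Rep-resp-↭ (Perm.shift b cs as)
    (Run-++ cs c (+-comm s b) (subst (λ n → suc n < q) (sym (+-assoc s b (sum cs))) lt)
      (Run-∷ (f (≤-trans (s≤s (s≤s (m≤m+n s (b + sum cs)))) lt)) run)
      (≤-trans i≤ (≤-reflexive (sum-↭ (↭-sym (Perm.shift b cs as))))))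

Residues-resp-↭ : ∀ {as bs v} → as ↭ bs → Residues as v ⊎ Exceptional as v → Residues bs v ⊎ Exceptional bs v
Residues-resp-↭ p (inj₁ (A , 1≤A , A<v , r)) = inj₁ (A , 1≤A , A<v , λ t<v → let j , w = r t<v in j , Rep-resp-↭ p w)
Residues-resp-↭ p (inj₂ (eq , inj₁ e)) = inj₂ (eq , inj₁ (↭-trans (↭-sym p) e))
Residues-resp-↭ p (inj₂ (eq , inj₂ e)) = inj₂ (eq , inj₂ (↭-trans (↭-sym p) e))

-- The ranges in `explore` are exhaustive: both `v` and the next coefficient are at most 1 plus the
-- full sum, which is `a + sum as`. A closed node settles all its continuations at once, through
-- `Run-++`.
explore-sound : ∀ {q} f a as ls cs v → T (explore f a as ls) → Sound (a ∷ as) ls →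
  Chain q a (a + sum as) cs → suc (a + sum as + sum cs) < q →
  a < v → All (_< v) cs → v ≤ suc (a + sum as + sum cs) →
  Residues (cs ++ a ∷ as) v ⊎ Exceptional (cs ++ a ∷ as) v
explore-sound {q} (suc f) a as ls cs v t sound c lt a<v cs<v v≤
  with T-case {anyBelow a (λ k → run? ls (a + sum as) (suc k))} t
... | inj₁ u with anyBelow-sound a (λ k → run? ls (a + sum as) (suc k)) u
...   | k , k<a , w = inj₁ (Run⇒Residues (s≤s z≤n) (≤-trans (s≤s k<a) a<v)
          (subst (λ s → v ≤ suc s) (trans (+-comm _ (sum cs)) (sym (sum-++ cs (a ∷ as)))) v≤)
          (Run-++ cs c refl lt λ {i} i≤ → sound (suc k) (suc k + i)
            (allBelow-sound (suc (a + sum as)) (λ i → bit (level ls (suc k)) (suc k + i)) w (s≤s i≤))))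
explore-sound {q} (suc f) a as ls [] v t sound c lt a<v cs<v v≤ | inj₂ u =
  terminal?-sound ls sound v (subst (T ∘ terminal? ls (a ∷ as)) (m+[n∸m]≡n a<v)
    (allBelow-sound (suc (sum as)) (λ i → terminal? ls (a ∷ as) (suc a + i)) (proj₁ (T-split u))
      (s≤s (subst (v ∸ suc a ≤_) (m+n∸m≡n a (sum as))
        (∸-monoˡ-≤ (suc a) (subst (λ s → v ≤ suc s) (+-identityʳ _) v≤))))))
explore-sound {q} (suc f) a as ls (b ∷ cs) v t sound (link a≤b f≤ c) lt a<v (b<v ∷ cs<v) v≤ | inj₂ u =
  Residues-resp-↭ (Perm.shift b cs (a ∷ as))
    (explore-sound f b (a ∷ as) (extend b ls) cs v
      (subst (λ b → T (explore f b (a ∷ as) (extend b ls))) (m+[n∸m]≡n a≤b)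
        (allBelow-sound (suc (suc (sum as))) (λ i → explore f (a + i) (a ∷ as) (extend (a + i) ls))
          (proj₂ (T-split {allBelow (suc (sum as)) (λ i → terminal? ls (a ∷ as) (suc a + i))} u))
          (s≤s (subst (b ∸ a ≤_) (trans (cong (_∸ a) (sym (+-suc a (sum as)))) (m+n∸m≡n a (suc (sum as))))
            (∸-monoˡ-≤ a (f≤ (≤-trans (s≤s (s≤s (m≤m+n _ _))) lt)))))))
      (extend-sound ls sound)
      (subst (λ s → Chain q b s cs) (+-comm (a + sum as) b) c)
      (subst (λ s → suc s < q) eq lt) b<v cs<v (subst (λ s → v ≤ suc s) eq v≤))
  where
  eq : a + sum as + (b + sum cs) ≡ b + (a + sum as) + sum cs
  eq = lem (a + sum as) b (sum cs)
    where
    lem : ∀ s b t → s + (b + t) ≡ b + s + t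
    lem = solve-∀

table-[1]-sound : Sound (1 ∷ []) table-[1]
table-[1]-sound = extend-sound ((true ∷ []) ∷ []) λ { zero zero t → nil ; zero (suc D) () ; (suc A) D () }

residues : ∀ {q as v} → Chain q 1 0 as → suc (sum as) < q → 2 ≤ v → All (_< v) as → v ≤ suc (sum as) →
           Residues as v ⊎ Exceptional as v
residues [] lt (s≤s (s≤s z≤n)) as<v (s≤s ())
residues {as = a ∷ as} (link 1≤a f c) lt 2≤v (a<v ∷ as<v) v≤
  -- The chain starts from sum 0, which forces the first coefficient to be 1.
  with refl ← ≤-antisym (f (≤-trans (s≤s (s≤s z≤n)) lt)) 1≤a =
  Residues-resp-↭ (↭-sym (Perm.∷↭∷ʳ 1 as))
    (explore-sound 8 1 [] table-[1] as _ explore-[1] table-[1]-sound c lt a<v as<v v≤)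

-- Upper bound for the rank

-- Here `k` is the floor of `C`. The hypothesis on `m` gives `large` with `m - 1 = q + 2` on the
-- right, since both sides are integers.
record Large (k q : ℕ) : Set where
  field
    5≤k   : 5 ≤ k
    large : 6 * k * k * suc k ≤ q + 2

  private
    j = k ∸ 5
    k≡5+j : 5 + j ≡ k
    k≡5+j = m+[n∸m]≡n 5≤k

  -- Excludes the second alternative of `find-split`. Writing `k = 5 + j` turns the slack into a
  -- polynomial with positive coefficients.
  bound₁ : suc k * ((suc k + 2) * suc (suc k) + 1) ≤ q
  bound₁ = subst (λ k → 6 * k * k * suc k ≤ q + 2 → suc k * ((suc k + 2) * suc (suc k) + 1) ≤ q) k≡5+j
    (λ le → by-≤ (556 + 363 * j + 75 * j * j + 5 * j * j * j) le (lem j q)) large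
    where
    lem : ∀ j q → let k = 5 + j in
      suc k * ((suc k + 2) * suc (suc k) + 1) + (q + 2) + (556 + 363 * j + 75 * j * j + 5 * j * j * j)
      ≡ q + 6 * k * k * suc k
    lem = solve-∀

  -- Yields `s-bound`, as `bs` has at most `k (suc k + 2)` entries and `v ≤ suc k`.
  bound₂ : (2 * suc k + 3) * (k * (suc k + 2)) + (2 + 2 * k) ≤ q
  bound₂ = subst (λ k → 6 * k * k * suc k ≤ q + 2 → (2 * suc k + 3) * (k * (suc k + 2)) + (2 + 2 * k) ≤ q) k≡5+j
    (λ le → by-≤ (286 + 233 * j + 55 * j * j + 4 * j * j * j) le (lem j q)) large
    where
    lem : ∀ j q → let k = 5 + j in
      (2 * suc k + 3) * (k * (suc k + 2)) + (2 + 2 * k) + (q + 2) + (286 + 233 * j + 55 * j * j + 4 * j * j * j)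
      ≡ q + 6 * k * k * suc k
    lem = solve-∀

  342≤q : 342 ≤ q
  -- 342 is the left side of `bound₁` at `k = 5`.
  342≤q = ≤-trans (*-mono-≤ (s≤s 5≤k) (+-monoˡ-≤ 1 (*-mono-≤ (+-monoˡ-≤ 2 (s≤s 5≤k)) (s≤s (s≤s 5≤k))))) bound₁

-- Let `as` attain the residue of `Z` as `t + j * v`. By `Rep-bound` this is at most `Z`, so
-- `Z / v - j` copies of `v` set to 1 supply the rest.
fill : ∀ {as v A} L → 1 ≤ v → (∀ {t} → t < v → ∃ λ j → Rep as A (t + j * v)) →
  ∀ {Z} → 2 * A + sum as ≤ Z → Z ≤ L * v → Rep (as ++ replicate L v) A Z
fill {as} {v} {A} L 1≤v found {Z} ≤Z Z≤ = go (found (m%n<n Z v))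
  where
  instance
    v≢0 : NonZero v
    v≢0 = >-nonZero 1≤v
  t = Z % v
  i = Z / v
  Z≡ : Z ≡ t + i * v
  Z≡ = m≡m%n+[m/n]*n Z v
  go : (∃ λ j → Rep as A (t + j * v)) → Rep (as ++ replicate L v) A Z
  go (j , r) = subst₂ (Rep (as ++ replicate L v)) (+-identityʳ A) eq
                 (Rep-++ r (Rep-multiple v i∸j≤L))
    where
    open ≤-Reasoning
    j≤i : j ≤ i
    j≤i = *-cancelʳ-≤ j i v (+-cancelˡ-≤ t (j * v) (i * v)
            (≤-trans (Rep-bound r) (≤-trans ≤Z (≤-reflexive Z≡))))
    i∸j≤L : i ∸ j ≤ L
    i∸j≤L = ≤-trans (m∸n≤m i j) (*-cancelʳ-≤ i L v
      (≤-trans (m≤n+m (i * v) t) (≤-trans (≤-reflexive (sym Z≡)) Z≤)))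
    eq : t + j * v + (i ∸ j) * v ≡ Z
    eq = trans (+-assoc t (j * v) ((i ∸ j) * v))
           (trans (cong (_+_ t) (trans (sym (*-distribʳ-+ v j (i ∸ j))) (cong (_* v) (m+[n∸m]≡n j≤i)))) (sym Z≡))

few-small : ∀ {k q u s} → Large k q → u ≤ k → s ≤ u * (suc k + 2) → (2 * suc u + 3) * s + (2 + 2 * u) ≤ q
few-small {k} big u≤k s≤ =
  ≤-trans (+-mono-≤ (*-mono-≤ (+-monoˡ-≤ 3 (*-monoʳ-≤ 2 (s≤s u≤k))) (≤-trans s≤ (*-monoˡ-≤ (suc k + 2) u≤k)))
                    (+-monoʳ-≤ 2 (*-monoʳ-≤ 2 u≤k)))
          (Large.bound₂ big)

-- Arithmetic of a hypothetical truant T of bs ++ replicate L v ++ es with v = suc u, where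
-- s and B are the length and the sum of bs, and E and W are those of es.
module Sizes {k q u s L E W B T A : ℕ} (big : Large k q) (u≤k : u ≤ k)
  (sum< : suc (B + (L * suc u + W)) ≤ T) (T< : T < suc u * q)
  (rank : q ≤ s + (L + E)) (E≤ : E * suc (suc u) ≤ W)
  (s≤ : s ≤ u * (suc k + 2)) (B≤ : B ≤ s * u) (1≤A : 1 ≤ A) (A≤u : A ≤ u) where

  private
    v = suc u

  vq≤ : v * q ≤ v * (s + (L + E))
  vq≤ = *-monoʳ-≤ v rank

  vE≤W : v * E ≤ W
  vE≤W = by-≤ E E≤ (lem u E W)
    where
    lem : ∀ u E W → suc u * E + W + E ≡ W + E * suc (suc u)
    lem = solve-∀

  -- The sum is below `v q`, hence below `v (s + L + E)`; the copies of `v` cancel, and the excess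
  -- of `es` over `v E` is at most `v s`.
  W≤ : W ≤ v * s + v * E
  W≤ = by-≤ (2 + B) (≤-trans (s≤s sum<) (≤-trans T< vq≤)) (lem u s L E W B)
    where
    lem : ∀ u s L E W B → W + suc u * (s + (L + E)) + (2 + B) ≡
      suc u * s + suc u * E + suc (suc (B + (L * suc u + W)))
    lem = solve-∀

  E≤vs : E ≤ v * s
  E≤vs = by-≤ 0 (≤-trans E≤ W≤) (lem u s E)
    where
    lem : ∀ u s E → E + (suc u * s + suc u * E) + 0 ≡ suc u * s + E * suc (suc u)
    lem = solve-∀

  s-bound : (2 * v + 3) * s + (2 + 2 * u) ≤ q
  s-bound = few-small big u≤k s≤

  vs+2A≤q : v * s + 2 * A ≤ q
  vs+2A≤q = ≤-trans (+-monoʳ-≤ (v * s) (*-monoʳ-≤ 2 A≤u)) (by-≤ (v * s + 3 * s + 2) s-bound (lem u s q))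
    where
    lem : ∀ u s q → suc u * s + 2 * u + q + (suc u * s + 3 * s + 2) ≡ q + ((2 * suc u + 3) * s + (2 + 2 * u))
    lem = solve-∀

  -- `T` is at least `v q - v s + B`, while `A ≤ v - 1` leaves `q` to spare, enough for `v s + 2 A`.
  low : q * A + (2 * A + B) ≤ T
  low = by-≤ 1 (+-mono-≤ (*-monoʳ-≤ q (s≤s A≤u)) (+-mono-≤ vq≤ (+-mono-≤ vE≤W (+-mono-≤ sum< vs+2A≤q))))
    (lem q u s L E W B T A)
    where
    lem : ∀ q u s L E W B T A →
      q * A + (2 * A + B) + (q * suc u + (suc u * (s + (L + E)) + (W + (T + q)))) + 1 ≡
      T + (q * suc A + (suc u * q + (suc u * E + (suc (B + (L * suc u + W)) + (suc u * s + 2 * A)))))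
    lem = solve-∀

  -- `L v` is at least `v (q - s - E)`, while `E` and `W` are bounded in terms of `v` and `s`; so by
  -- `s-bound` it exceeds `W + 2 A + B`.
  low-with-es : q * A + L * v ≤ T → q * A + (W + (2 * A + B)) ≤ T
  low-with-es le = by-≤ (s + 2 * v + 2 * u * u)
    (+-mono-≤ le (+-mono-≤ vq≤ (+-mono-≤ (*-monoʳ-≤ v E≤vs) (+-mono-≤ W≤ (+-mono-≤ (*-monoʳ-≤ v E≤vs)
      (+-mono-≤ B≤ (+-mono-≤ (*-monoʳ-≤ 2 A≤u) (*-monoʳ-≤ v s-bound))))))))
    (lem q u s L E W B T A)
    where
    lem : ∀ q u s L E W B T A →
      q * A + (W + (2 * A + B)) + (T + (suc u * (s + (L + E)) + (suc u * (suc u * s) + (suc u * s + suc u * E +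
        (suc u * (suc u * s) + (s * u + (2 * u + suc u * q))))))) + (s + 2 * suc u + 2 * u * u) ≡
      T + (q * A + L * suc u + (suc u * q + (suc u * E + (W + (suc u * E + (B + (2 * A +
        suc u * ((2 * suc u + 3) * s + (2 + 2 * u)))))))))
    lem = solve-∀

  -- `L v + W` falls short of `v q` by at most `v s`, and `A ≥ 1` contributes `q`, which is larger.
  high : T ≤ q * A + (W + L * v)
  high = by-≤ (2 * A) (+-mono-≤ (<⇒≤ T<) (+-mono-≤ (*-monoʳ-≤ q 1≤A) (+-mono-≤ vq≤ (+-mono-≤ vE≤W vs+2A≤q))))
    (lem q u s L E W T A)
    where
    lem : ∀ q u s L E W T A →
      T + (suc u * q + (q * A + (suc u * (s + (L + E)) + (W + q)))) + (2 * A) ≡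
      q * A + (W + L * suc u) + (T + (q * 1 + (suc u * q + (suc u * E + (suc u * s + 2 * A)))))
    lem = solve-∀

k<q : ∀ {k q} → Large k q → suc k ≤ q
k<q {k} big = ≤-trans
  (m≤m*n (suc k) ((suc k + 2) * suc (suc k) + 1) ⦃ >-nonZero (m≤n+m 1 ((suc k + 2) * suc (suc k))) ⦄)
  (Large.bound₁ big)

-- Numbers below `K (q + 1)` have `A ≤ K`, because `K ≤ q`; so `K + 3` copies are enough for
-- `shift`.
Val-shift : ∀ {k q N} u bs L es → Large k q → suc k + 3 ≤ L → N < suc k * suc q → suc u * q ≤ N →
  Val q (bs ++ replicate L (suc u) ++ es) (N ∸ suc u * q) → Val q (bs ++ replicate L (suc u) ++ es) N
Val-shift {k} {q} {N} u bs L es big many N<K vq≤N (val {A} {D} r eq) =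
  val (shift {suc u} (s≤s z≤n) bs L es (≤-trans (+-monoˡ-≤ 3 A≤K) many) r)
      (trans (lem q (suc u) A D) (trans (cong (_+_ (suc u * q)) eq) (m+[n∸m]≡n vq≤N)))
  where
  K = suc k
  lem : ∀ q v A D → q * (v + A) + D ≡ v * q + (q * A + D)
  lem = solve-∀
  A≤K : A ≤ K
  A≤K = ≮⇒≥ λ K<A → <⇒≱ N<K (begin
    K * suc q       ≡⟨ *-suc K q ⟩
    K + K * q       ≤⟨ +-monoˡ-≤ (K * q) (k<q big) ⟩
    suc K * q       ≤⟨ *-monoˡ-≤ q K<A ⟩
    A * q           ≡⟨ *-comm A q ⟩
    q * A           ≤⟨ m≤m+n (q * A) D ⟩
    q * A + D       ≡⟨ eq ⟩
    N ∸ suc u * q   ≤⟨ m∸n≤m N (suc u * q) ⟩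
    N               ∎)
    where open ≤-Reasoning

truant<multiple : ∀ {k q T} u bs L es → Large k q → suc k + 3 ≤ L →
  Truant q (bs ++ replicate L (suc u) ++ es) T → T < suc k * suc q → T < suc u * q
truant<multiple {q = q} u bs L es big many truant T<K = ≰⇒> λ vq≤T →
  missed truant (Val-shift u bs L es big many T<K vq≤T (reached truant (∸-monoʳ-< 0<vq vq≤T)))
  where
  0<vq : 0 < suc u * q
  0<vq = ≤-trans (s≤s z≤n) (≤-trans (k<q big) (m≤m+n q (u * q)))

Rep-assoc : ∀ {A D A′ D′} bs L v es → Rep (bs ++ replicate L v) A D → Rep es A′ D′ →
            Rep (bs ++ replicate L v ++ es) (A + A′) (D + D′)
Rep-assoc bs L v es r s =
  subst (λ as → Rep as _ _) (++-assoc bs (replicate L v) es) (Rep-++ r s)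

-- With the variables of `es` at 0, `fill` works up to `q A + L v`. If `T` is larger, setting them
-- all to 1 moves the range up by `W`, and then it contains `T`.
residues⇒¬truant : ∀ {k q T} u bs L es → Large k q → u ≤ k → Residues bs (suc u) →
  suc (sum bs + (L * suc u + sum es)) ≤ T → T < suc u * q → q ≤ length bs + (L + length es) →
  length es * suc (suc u) ≤ sum es → length bs ≤ u * (suc k + 2) → sum bs ≤ length bs * u →
  ¬ Truant q (bs ++ replicate L (suc u) ++ es) T
residues⇒¬truant {k} {q} {T} u bs L es big u≤k (A , 1≤A , s≤s A≤u , found) sum< T< rank E≤ s≤ B≤ truant =
  missed truant (reach (T ≤? q * A + L * suc u))
  where
  open Sizes {s = length bs} {L = L} {E = length es} {W = sum es} big u≤k sum< T< rank E≤ s≤ B≤ 1≤A A≤u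
  W = sum es
  qA≤T : q * A ≤ T
  qA≤T = ≤-trans (m≤m+n (q * A) _) low
  reach : Dec (T ≤ q * A + L * suc u) → Val q (bs ++ replicate L (suc u) ++ es) T
  reach (yes T≤) = val (Rep-assoc bs L (suc u) es (fill L (s≤s z≤n) found ≤Z Z≤) (Rep-zeros es))
    (trans (lem q A (T ∸ q * A)) (m+[n∸m]≡n qA≤T))
    where
    ≤Z : 2 * A + sum bs ≤ T ∸ q * A
    ≤Z = subst (_≤ T ∸ q * A) (m+n∸m≡n (q * A) (2 * A + sum bs)) (∸-monoˡ-≤ (q * A) low)
    Z≤ : T ∸ q * A ≤ L * suc u
    Z≤ = subst (T ∸ q * A ≤_) (m+n∸m≡n (q * A) (L * suc u)) (∸-monoˡ-≤ (q * A) T≤)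
    lem : ∀ q A Z → q * (A + 0) + (Z + 0) ≡ q * A + Z
    lem = solve-∀
  reach (no T≰) = val (Rep-assoc bs L (suc u) es (fill L (s≤s z≤n) found ≤Z Z≤) (Rep-ones es))
    (trans (lem q A W (T ∸ (q * A + W))) (m+[n∸m]≡n qA+W≤T))
    where
    low′ : q * A + W + (2 * A + sum bs) ≤ T
    low′ = subst (_≤ T) (sym (+-assoc (q * A) W _)) (low-with-es (<⇒≤ (≰⇒> T≰)))
    qA+W≤T : q * A + W ≤ T
    qA+W≤T = ≤-trans (m≤m+n (q * A + W) _) low′
    ≤Z : 2 * A + sum bs ≤ T ∸ (q * A + W)
    ≤Z = subst (_≤ T ∸ (q * A + W)) (m+n∸m≡n (q * A + W) (2 * A + sum bs)) (∸-monoˡ-≤ (q * A + W) low′)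
    Z≤ : T ∸ (q * A + W) ≤ L * suc u
    Z≤ = subst (T ∸ (q * A + W) ≤_)
      (trans (cong (_∸ (q * A + W)) (sym (+-assoc (q * A) W (L * suc u)))) (m+n∸m≡n (q * A + W) (L * suc u)))
      (∸-monoˡ-≤ (q * A + W) high)
    lem : ∀ q A W Z → q * (A + 0) + (Z + W) ≡ q * A + W + Z
    lem = solve-∀

-- Since the truant exceeds the sum of the coefficients, it is 3q - 3, 3q - 2 or 3q - 1.
module ExceptionalTruant {k q T L : ℕ} {bs es : List ℕ} (big : Large k q)
  (truant : Truant q (bs ++ replicate L 3 ++ es) T)
  (sum< : suc (sum bs + (L * 3 + sum es)) ≤ T) (T< : T < 3 * q)
  (E≤ : length es * 4 ≤ sum es) (perm : bs ↭ 1 ∷ 1 ∷ [] ⊎ bs ↭ 1 ∷ 2 ∷ []) where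

  private
    E = length es

  length-bs : length bs ≡ 2
  length-bs = [ Perm.↭-length , Perm.↭-length ]′ perm

  2≤sum : 2 ≤ sum bs
  2≤sum = [ (λ p → ≤-reflexive (sym (sum-↭ p))) , (λ p → ≤-trans (s≤s (s≤s z≤n)) (≤-reflexive (sym (sum-↭ p)))) ]′ perm

  sum<′ : suc (2 + (L * 3 + E * 4)) ≤ T
  sum<′ = ≤-trans (s≤s (+-mono-≤ 2≤sum (+-monoʳ-≤ (L * 3) E≤))) sum<

  -- Rank above `q` gives `3 + 3 L + 4 E ≥ 3 q`, contrary to `T < 3 q`.
  long : ¬ suc q ≤ length bs + (L + E)
  long rank = n≮0 {0} (by-≤ E (+-mono-≤ (≤-trans (s≤s sum<′) T<)
      (*-monoʳ-≤ 3 (subst (λ s → suc q ≤ s + (L + E)) length-bs rank))) (lem q L E))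
    where
    lem : ∀ q L E → 1 + (3 * q + 3 * (2 + (L + E))) + E ≡ 0 + (suc (suc (2 + (L * 3 + E * 4))) + 3 * suc q)
    lem = solve-∀

  module _ (w : ℕ) (q≡ : q ≡ 2 + w * 3) (rank : q ≤ length bs + (L + E)) where

    rank′ : q ≤ 2 + (L + E)
    rank′ = subst (λ s → q ≤ s + (L + E)) length-bs rank

    3q+E≤T+3 : 3 * q + E ≤ T + 3
    3q+E≤T+3 = by-≤ 0 (+-mono-≤ (*-monoʳ-≤ 3 rank′) sum<′) (lem q L E T)
      where
      lem : ∀ q L E T → 3 * q + E + (3 * (2 + (L + E)) + T) + 0 ≡ T + 3 + (3 * q + suc (2 + (L * 3 + E * 4)))
      lem = solve-∀

    E≤2 : E ≤ 2
    E≤2 = by-≤ 0 (+-mono-≤ 3q+E≤T+3 T<) (lem q E T)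
      where
      lem : ∀ q E T → E + (T + 3 + 3 * q) + 0 ≡ 2 + (3 * q + E + suc T)
      lem = solve-∀

    3≤w : 3 ≤ w
    3≤w = *-cancelʳ-≤ 3 w 3 (+-cancelˡ-≤ 2 9 (w * 3)
      (subst (11 ≤_) q≡ (≤-trans (≤ᵇ⇒≤ 11 342 _) (Large.342≤q big))))

    2w+1≤L : suc (2 * w) ≤ L
    2w+1≤L = by-≤ 0 (+-mono-≤ (subst (_≤ 2 + (L + E)) q≡ rank′) (+-mono-≤ E≤2 3≤w)) (lem w L E)
      where
      lem : ∀ w L E → suc (2 * w) + (2 + (L + E) + (2 + w)) + 0 ≡ L + (2 + w * 3 + (E + 3))
      lem = solve-∀

    2w≤L : 2 * w ≤ L
    2w≤L = ≤-trans (n≤1+n _) 2w+1≤L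

    w≤L : w ≤ L
    w≤L = ≤-trans (m≤m+n w (w + 0)) 2w≤L

    -- The offset of `T` from `3 q - 3`.
    d : ℕ
    d = T + 3 ∸ 3 * q

    3q+d≡T+3 : 3 * q + d ≡ T + 3
    3q+d≡T+3 = m+[n∸m]≡n (≤-trans (m≤m+n (3 * q) E) 3q+E≤T+3)

    d≤2 : d ≤ 2
    d≤2 = by-≤ 0 (+-mono-≤ (≤-reflexive 3q+d≡T+3) T<) (lem q d T)
      where
      lem : ∀ q d T → d + (T + 3 + 3 * q) + 0 ≡ 2 + (3 * q + d + suc T)
      lem = solve-∀

    T≡ : T + 3 ≡ 6 + 9 * w + d
    T≡ = trans (sym 3q+d≡T+3) (trans (cong (λ q → 3 * q + d) q≡) (lem w d))
      where
      lem : ∀ w d → 3 * (2 + w * 3) + d ≡ 6 + 9 * w + d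
      lem = solve-∀

    attained : ∀ {A D} j → Rep bs A D → j ≤ L → (2 + w * 3) * A + (D + j * 3) + 3 ≡ 6 + 9 * w + d → ⊥
    attained {A} {D} j r j≤L eq = missed truant
      (val (Rep-assoc bs L 3 es (Rep-++ r (Rep-multiple 3 j≤L)) (Rep-zeros es))
        (+-cancelʳ-≡ 3 _ _ (trans
          (trans (cong (λ q → q * (A + 0 + 0) + (D + j * 3 + 0) + 3) q≡) (lem (2 + w * 3) A (D + j * 3)))
          (trans eq (sym T≡)))))
      where
      lem : ∀ q A D → q * (A + 0 + 0) + (D + 0) + 3 ≡ q * A + D + 3
      lem = solve-∀

    [1,1] : ∀ x y → Rep (1 ∷ 1 ∷ []) (1 * t⁻ x + (1 * t⁻ y + 0)) (1 * t⁺ x + (1 * t⁺ y + 0))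
    [1,1] x y = cons x refl refl (cons y refl refl nil)

    [1,2] : ∀ x y → Rep (1 ∷ 2 ∷ []) (1 * t⁻ x + (2 * t⁻ y + 0)) (1 * t⁺ x + (2 * t⁺ y + 0))
    [1,2] x y = cons x refl refl (cons y refl refl nil)

    impossible : ⊥
    impossible = go perm d refl d≤2
      where
      go : bs ↭ 1 ∷ 1 ∷ [] ⊎ bs ↭ 1 ∷ 2 ∷ [] → ∀ e → e ≡ d → e ≤ 2 → ⊥
      -- As `q = 3 w + 2` and `T = 9 w + 3 + d`, taking `A = 1` requires `D ≡ d - 2` modulo 3. For
      -- (1 , 1) this fails only at `d = 1`, where `A = 2` and `D ≡ 0` serve instead.
      go (inj₁ p) 0 eq _ = attained (2 * w) (Rep-resp-↭ (↭-sym p) ([1,1] -[1+ 0 ] (+ 1))) 2w≤L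
        (trans (lem w) (cong (_+_ (6 + 9 * w)) eq))
        where
        lem : ∀ w → (2 + w * 3) * 1 + (1 + 2 * w * 3) + 3 ≡ 6 + 9 * w + 0
        lem = solve-∀
      go (inj₁ p) 1 eq _ = attained w (Rep-resp-↭ (↭-sym p) ([1,1] -[1+ 0 ] -[1+ 0 ])) w≤L
        (trans (lem w) (cong (_+_ (6 + 9 * w)) eq))
        where
        lem : ∀ w → (2 + w * 3) * 2 + (0 + w * 3) + 3 ≡ 6 + 9 * w + 1
        lem = solve-∀
      go (inj₁ p) 2 eq _ = attained (suc (2 * w)) (Rep-resp-↭ (↭-sym p) ([1,1] -[1+ 0 ] (+ 0))) 2w+1≤L
        (trans (lem w) (cong (_+_ (6 + 9 * w)) eq))
        where
        lem : ∀ w → (2 + w * 3) * 1 + (0 + suc (2 * w) * 3) + 3 ≡ 6 + 9 * w + 2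
        lem = solve-∀
      -- Here `bs` has sum 3, so the coefficients already add up to at least `3 q - 3`, and `T`
      -- cannot be that small.
      go (inj₂ p) 0 eq _ = n≮0 {0} (by-≤ E (+-mono-≤ (*-monoʳ-≤ 3 rank′) (+-mono-≤ sum<″ T+3≤3q)) (lem q L E T))
        where
        T+3≤3q : T + 3 ≤ 3 * q
        T+3≤3q = ≤-reflexive (trans (sym 3q+d≡T+3) (trans (cong (_+_ (3 * q)) (sym eq)) (+-identityʳ (3 * q))))
        lem : ∀ q L E T → 1 + (3 * (2 + (L + E)) + (T + 3 * q)) + E ≡ 0 + (3 * q + (suc (3 + (L * 3 + E * 4)) + (T + 3)))
        lem = solve-∀
        sum<″ : suc (3 + (L * 3 + E * 4)) ≤ T
        sum<″ = ≤-trans (s≤s (+-mono-≤ (≤-reflexive (sym (sum-↭ p))) (+-monoʳ-≤ (L * 3) E≤))) sum<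
      go (inj₂ p) 1 eq _ = attained (2 * w) (Rep-resp-↭ (↭-sym p) ([1,2] -[1+ 0 ] (+ 1))) 2w≤L
        (trans (lem w) (cong (_+_ (6 + 9 * w)) eq))
        where
        lem : ∀ w → (2 + w * 3) * 1 + (2 + 2 * w * 3) + 3 ≡ 6 + 9 * w + 1
        lem = solve-∀
      go (inj₂ p) 2 eq _ = attained (suc (2 * w)) (Rep-resp-↭ (↭-sym p) ([1,2] -[1+ 0 ] (+ 0))) 2w+1≤L
        (trans (lem w) (cong (_+_ (6 + 9 * w)) eq))
        where
        lem : ∀ w → (2 + w * 3) * 1 + (0 + suc (2 * w) * 3) + 3 ≡ 6 + 9 * w + 2
        lem = solve-∀
      go _ (suc (suc (suc _))) _ (s≤s (s≤s ()))

head-≤ : ∀ {q lo s a as} → Chain q lo s (a ∷ as) → suc s < q → a ≤ suc s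
head-≤ (link _ a≤ _) = a≤

split⇒¬truant : ∀ {k q T u bs es} L → Large k q → u < k → Chain q 1 0 (bs ++ replicate (suc L) (2 + u) ++ es) →
  All (_≤ suc u) bs → All (3 + u ≤_) es → length bs ≤ suc u * (suc k + 2) → suc k + 3 ≤ suc L →
  sum (bs ++ replicate (suc L) (2 + u) ++ es) < T → T < suc k * suc q →
  q ≤ length (bs ++ replicate (suc L) (2 + u) ++ es) →
  (q % 3 ≡ 2 ⊎ suc q ≤ length (bs ++ replicate (suc L) (2 + u) ++ es)) →
  ¬ Truant q (bs ++ replicate (suc L) (2 + u) ++ es) T
split⇒¬truant {k} {q} {T} {u} {bs} {es} L′ big u<k chain below above few many sum<T T<K q≤n longer truant =
  -- By `B<q` the chain bound still applies to the first copy of `v`, which gives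
  -- `v ≤ suc (sum bs)`.
  finish (residues (proj₁ (Chain-++⁻ bs chain)) B<q (s≤s (s≤s z≤n)) (All.map s≤s below)
    (head-≤ (proj₂ (Chain-++⁻ bs chain)) B<q))
  where
  L = suc L′
  v = suc (suc u)
  s = length bs
  B≤ : sum bs ≤ s * suc u
  B≤ = sum≤length*hi below
  B<q : suc (sum bs) < q
  B<q = by-≤ (2 * u + 6 * s + s * u + 2 ) (+-mono-≤ B≤ (few-small big u<k few)) (lem (sum bs) s u q)
    where
    lem : ∀ B s u q → suc (suc B) + (s * suc u + q) + (2 * u + 6 * s + s * u + 2) ≡
      q + (B + ((2 * suc (suc u) + 3) * s + (2 + 2 * suc u)))
    lem = solve-∀
  n≡ : length (bs ++ replicate L v ++ es) ≡ s + (L + length es)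
  n≡ = trans (length-++ bs) (cong (_+_ s) (trans (length-++ (replicate L v)) (cong (_+ length es) (length-replicate L))))
  sum≡ : sum (bs ++ replicate L v ++ es) ≡ sum bs + (L * v + sum es)
  sum≡ = trans (sum-++ bs _) (cong (_+_ (sum bs)) (trans (sum-++ (replicate L v) es) (cong (_+ sum es) (sum-replicate L v))))
  sum<T′ : suc (sum bs + (L * v + sum es)) ≤ T
  sum<T′ = subst (λ S → suc S ≤ T) sum≡ sum<T
  T<vq : T < v * q
  T<vq = truant<multiple (suc u) bs L es big many truant T<K
  E≤ : length es * suc v ≤ sum es
  E≤ = length*lo≤sum above
  rank : ∀ {n} → n ≤ length (bs ++ replicate L v ++ es) → n ≤ s + (L + length es)
  rank = subst (_ ≤_) n≡
  finish : Residues bs v ⊎ Exceptional bs v → ⊥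
  finish (inj₁ r) = residues⇒¬truant (suc u) bs L es big u<k r sum<T′ T<vq (rank q≤n) E≤ few B≤ truant
  finish (inj₂ (refl , perm)) =
    -- For other residues of `q` exceptional nodes of rank `q` exist, namely the parents of the
    -- leaves of rank `q + 1`; hence the hypothesis `longer`.
    [ (λ q%3≡2 → impossible (q / 3) (trans (m≡m%n+[m/n]*n q 3) (cong (_+ q / 3 * 3) q%3≡2)) (rank q≤n))
    , (λ q<n → long (rank q<n)) ]′ longer
    where open ExceptionalTruant {L = suc L′} {bs = bs} {es = es} big truant sum<T′ T<vq E≤ perm

-- Without a frequent coefficient the sum is too large. If 1 is frequent, then `T < q`, yet the sum
-- is at least the rank. The remaining case is `split⇒¬truant`.
no-long-truant : ∀ {k q T as} → Large k q → Node (3 + q) as → Truant q as T → T < suc k * suc q →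
  q ≤ length as → (q % 3 ≡ 2 ⊎ suc q ≤ length as) → ⊥
no-long-truant {k} {q} {T} {as} big node truant T<K q≤n longer =
  go (find-split (suc k) [] as (suc k) 0 chain (+-identityʳ (suc k)) [] chain z≤n)
  where
  K = suc k
  1≤q : 1 ≤ q
  1≤q = ≤-trans (≤ᵇ⇒≤ 1 342 _) (Large.342≤q big)
  chain : Chain q 1 0 as
  chain = node-chain 1≤q node
  sum<T : sum as < T
  sum<T = sum<truant 1≤q node truant
  go : (∃ λ u → u < K × Split q as K u) ⊎ length as * suc K ≤ K * (K + 2) * suc K + sum as → ⊥
  go (inj₂ le) = n≮0 {0} (by-≤ 1 (+-mono-≤ (≤-trans (*-monoˡ-≤ (suc K) q≤n) le)
      (+-mono-≤ (≤-trans (s≤s sum<T) T<K) (Large.bound₁ big))) (lem q K (sum as)))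
    where
    lem : ∀ q K S → 1 + (K * (K + 2) * suc K + S + (K * suc q + q)) + 1 ≡
      0 + (q * suc K + (suc (suc S) + K * ((K + 2) * suc K + 1)))
    lem = solve-∀
  go (inj₁ (zero , _ , record { bs = bs ; es = es ; L = L ; shape = refl ; many = many })) =
    <-irrefl refl (begin-strict
      q                ≤⟨ q≤n ⟩
      length as        ≡⟨ *-identityʳ (length as) ⟨
      length as * 1    ≤⟨ length*lo≤sum (Chain-≤ chain) ⟩
      sum as           <⟨ sum<T ⟩
      T                <⟨ truant<multiple 0 bs L es big many truant T<K ⟩
      1 * q            ≡⟨ *-identityˡ q ⟩
      q                ∎)
    where open ≤-Reasoning
  go (inj₁ (suc u , s≤s u<k , record { L = zero ; many = () }))
  go (inj₁ (suc u , s≤s u<k , record { L = suc L ; shape = refl ; below = below ; above = above ; few = few ; many = many })) =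
    split⇒¬truant L big u<k chain below above few many sum<T T<K q≤n longer truant

-- The constant C

/1-≤ : ∀ N n M d → (+ N ℚᵘ./ 1) ℚᵘ.≤ mkℚᵘ (+ n) d ℚᵘ.* (+ M ℚᵘ./ 1) → N * suc d ≤ n * M
/1-≤ N n M d (ℚᵘ.*≤* le) = ℤ.drop‿+≤+ (subst₂ ℤ._≤_
  (trans (sym (ℤ.pos-* N (suc d * 1))) (cong (λ z → + (N * z)) (*-identityʳ (suc d))))
  (trans (ℤ.*-identityʳ _) (sym (ℤ.pos-* n M))) le)

-- For q = 1, that is m = 4, this form is x² + y² + 2z².
[1,1,2]-below-14 : ∀ {N} → N < 14 → Val 1 (1 ∷ 1 ∷ 2 ∷ []) N
[1,1,2]-below-14 = from-yes (allUpTo? (Val? 1 ≤-refl (1 ∷ 1 ∷ 2 ∷ []) (s≤s z≤n ∷ s≤s z≤n ∷ s≤s z≤n ∷ [])) 14)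

[1,1,2]-misses-14 : ¬ Val 1 (1 ∷ 1 ∷ 2 ∷ []) 14
[1,1,2]-misses-14 = from-no (Val? 1 ≤-refl (1 ∷ 1 ∷ 2 ∷ []) (s≤s z≤n ∷ s≤s z≤n ∷ s≤s z≤n ∷ []) 14)

-- The form above first fails at 14 and here `m - 2 = 2`, so a good constant is at least 7.
good⇒¬2C<14 : ∀ C → GoodConstant C →
  ¬ (∀ N → 1 ≤ N → (+ N ℚᵘ./ 1) ℚᵘ.≤ C ℚᵘ.* (+ 2 ℚᵘ./ 1) → N < 14)
good⇒¬2C<14 C good small = [1,1,2]-misses-14 (Represents⇒Val 1 (1 ∷ 1 ∷ 2 ∷ []) 14
  (good 4 (s≤s (s≤s (s≤s z≤n))) (1 ∷ 1 ∷ 2 ∷ [])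
    ((s≤s z≤n ∷ s≤s z≤n ∷ s≤s z≤n ∷ []) , (≤-refl ∷ s≤s z≤n ∷ [-]))
    (λ N 1≤N le → Val⇒Represents 1 _ N ([1,1,2]-below-14 (small N 1≤N le)))
    14 (s≤s z≤n)))

good-positive : ∀ p d → GoodConstant (mkℚᵘ p d) → ∃ λ n → p ≡ + n × 7 * suc d ≤ n
good-positive (+ n) d good = n , refl , ≮⇒≥ λ n<7d → good⇒¬2C<14 (mkℚᵘ (+ n) d) good λ N _ le →
  *-cancelʳ-< (suc d) N 14 (begin-strict
    N * suc d         ≤⟨ /1-≤ N n 2 d le ⟩
    n * 2             <⟨ *-monoˡ-< 2 n<7d ⟩
    7 * suc d * 2     ≡⟨ lem (suc d) ⟩
    14 * suc d        ∎)
  where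
  open ≤-Reasoning
  lem : ∀ d → 7 * d * 2 ≡ 14 * d
  lem = solve-∀
good-positive -[1+ n ] d good = ⊥-elim (good⇒¬2C<14 (mkℚᵘ -[1+ n ] d) good λ { (suc N) _ (ℚᵘ.*≤* ()) })

record Floor (C : ℚᵘ) (k : ℕ) : Set where
  field
    n d   : ℕ
    C≡    : C ≡ mkℚᵘ (+ n) d
    lower : k * suc d ≤ n
    upper : n < suc k * suc d

floor : ∀ C → GoodConstant C → ∃ λ k → 5 ≤ k × Floor C k
floor (mkℚᵘ p d) good with good-positive p d good
... | n , refl , 7d≤n = n / suc d , 5≤k , record
  { n = n ; d = d ; C≡ = refl ; lower = m/n*n≤m n (suc d) ; upper = upper }
  where
  open ≤-Reasoning
  upper : n < suc (n / suc d) * suc d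
  upper = begin-strict
    n                                 ≡⟨ m≡m%n+[m/n]*n n (suc d) ⟩
    n % suc d + n / suc d * suc d     <⟨ +-monoˡ-< (n / suc d * suc d) (m%n<n n (suc d)) ⟩
    suc d + n / suc d * suc d         ∎
  5≤k : 5 ≤ n / suc d
  5≤k = ≤-trans (m≤m+n 5 2) (s≤s⁻¹ (*-cancelʳ-< (suc d) 7 (suc (n / suc d)) (≤-<-trans 7d≤n upper)))

Floor⇒Large : ∀ {C k q} → 5 ≤ k → Floor C k →
  (+ 6 ℚᵘ./ 1) ℚᵘ.* C ℚᵘ.* C ℚᵘ.* (C ℚᵘ.+ (+ 1 ℚᵘ./ 1)) ℚᵘ.< (+ (3 + q) ℚᵘ./ 1) → Large k q
Floor⇒Large {k = k} {q} 5≤k record { n = n ; d = d ; C≡ = refl ; lower = lower } (ℚᵘ.*<* lt) = record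
  { 5≤k = 5≤k
  ; large = subst (6 * k * k * suc k ≤_) (+-comm 2 q) (s≤s⁻¹ (*-cancelʳ-< (D * D * D) _ _ (begin-strict
      6 * k * k * suc k * (D * D * D)        ≡⟨ lem k D ⟩
      6 * (k * D) * (k * D) * (k * D + D)    ≤⟨ *-mono-≤ (*-mono-≤ (*-monoʳ-≤ 6 lower) lower) (+-monoˡ-≤ D lower) ⟩
      6 * n * n * (n + D)                    <⟨ lt′ ⟩
      (3 + q) * (D * D * D)                  ∎)))
  }
  where
  open ≤-Reasoning
  D = suc d
  lem : ∀ k D → 6 * k * k * suc k * (D * D * D) ≡ 6 * (k * D) * (k * D) * (k * D + D)
  lem = solve-∀
  lem₂ : ∀ q D → (3 + q) * (1 * D * D * (D * 1)) ≡ (3 + q) * (D * D * D)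
  lem₂ = solve-∀
  lhs : + 6 ℤ.* + n ℤ.* + n ℤ.* (+ n ℤ.* + 1 ℤ.+ + 1 ℤ.* + D) ℤ.* + 1 ≡ + (6 * n * n * (n + D))
  lhs = trans (ℤ.*-identityʳ _) (trans (cong₂ ℤ._*_
      (trans (cong (ℤ._* + n) (sym (ℤ.pos-* 6 n))) (sym (ℤ.pos-* (6 * n) n)))
      (cong₂ ℤ._+_ (ℤ.*-identityʳ (+ n)) (ℤ.*-identityˡ (+ D))))
    (sym (ℤ.pos-* (6 * n * n) (n + D))))
  lt′ : 6 * n * n * (n + D) < (3 + q) * (D * D * D)
  lt′ = ℤ.drop‿+<+ (subst₂ ℤ._<_ lhs
    (trans (sym (ℤ.pos-* (3 + q) (1 * D * D * (D * 1)))) (cong +_ (lem₂ q D))) lt)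

-- Since `m - 2 = suc q` and `C < suc k`, every number up to `C (m - 2)` lies below `suc k * suc q`.
good⇒universal : ∀ C {k q as} → GoodConstant C → Floor C k → IsForm as →
  (∀ {N} → N < suc k * suc q → Val q as N) → Universal (3 + q) as
good⇒universal _ {k = k} {q} {as} good record { n = n ; d = d ; C≡ = refl ; upper = upper } form reach =
  good (3 + q) (s≤s (s≤s (s≤s z≤n))) as form λ N _ le → Val⇒Represents q as N (reach
    (*-cancelʳ-< (suc d) N (suc k * suc q) (begin-strict
      N * suc d                ≤⟨ /1-≤ N n (suc q) d le ⟩
      n * suc q                <⟨ *-monoˡ-< (suc q) upper ⟩
      suc k * suc d * suc q    ≡⟨ lem (suc k) (suc d) (suc q) ⟩
      suc k * suc q * suc d    ∎)))
  where
  open ≤-Reasoning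
  lem : ∀ k d q → k * d * q ≡ k * q * d
  lem = solve-∀

truant-bound : ∀ C {k q as T} → GoodConstant C → Floor C k → IsForm as → Truant q as T → T < suc k * suc q
truant-bound C {q = q} {as} {T} good fl form truant = ≰⇒> λ K≤T → missed truant
  (Represents⇒Val q as T (good⇒universal C good fl form (λ N<K → reached truant (≤-trans N<K K≤T)) T (positive truant)))

-- Leaves of maximal rank

truant-search : ∀ {q as} → 1 ≤ q → All (1 ≤_) as → ∀ n → (∀ {N} → N < n → Val q as N) ⊎ ∃ (Truant q as)
truant-search 1≤q 1≤as zero = inj₁ λ ()
truant-search {q} {as} 1≤q 1≤as (suc n) with truant-search 1≤q 1≤as n
... | inj₂ t = inj₂ t
... | inj₁ below with Val? q 1≤q as 1≤as n
...   | yes v = inj₁ λ {N} N<1+n → case m≤n⇒m<n∨m≡n (s≤s⁻¹ N<1+n) of λ { (inj₁ N<n) → below N<n ; (inj₂ refl) → v }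
...   | no ¬v = inj₂ (n , record { positive = n≢0⇒n>0 (λ { refl → ¬v Val-zero }) ; missed = ¬v ; reached = below })

truant-exists : ∀ {q as N} → 1 ≤ q → All (1 ≤_) as → ¬ Val q as N → ∃ (Truant q as)
truant-exists {N = N} 1≤q 1≤as ¬v with truant-search 1≤q 1≤as (suc N)
... | inj₁ below = contradiction (below ≤-refl) ¬v
... | inj₂ t     = t

-- The truant `T` exceeds the sum, so `a ≤ T`; the old form represents `T - a`, and the new variable
-- 1 adds `a`. The number `N` only witnesses that a truant exists.
grow : ∀ {q as N} a → 1 ≤ q → Node (3 + q) as → ¬ Val q as N → 1 ≤ a → LastBound as ≤ a → a ≤ suc (sum as) →
       Node (3 + q) (as ∷ʳ a)
grow {q} {as} a 1≤q node ¬v 1≤a last≤a a≤ with truant-exists 1≤q (Chain-≤ (node-chain 1≤q node)) ¬v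
... | T , truant = child a T node (Truant⇒IsTruant q as T truant) last≤a (Val⇒Represents q (as ∷ʳ a) T
      (subst (Val q (as ∷ʳ a)) (m+[n∸m]≡n a≤T) (Val-∷ʳ (reached truant (∸-monoʳ-< 1≤a a≤T)))))
  where
  a≤T : a ≤ T
  a≤T = ≤-trans a≤ (sum<truant 1≤q node truant)

Val-prefix : ∀ {q as N} bs → ¬ Val q (as ++ bs) N → ¬ Val q as N
Val-prefix bs ¬v v = ¬v (Val-++ˡ bs v)

last-or-threes : ∀ {lo} j → lo ≤ 3 → last-or lo (replicate j 3) ≤ 3
last-or-threes zero    lo≤3 = lo≤3
last-or-threes (suc j) _    = last-or-threes j ≤-refl

replicate-∷ʳ : ∀ j → replicate j 3 ∷ʳ 3 ≡ replicate (suc j) 3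
replicate-∷ʳ zero    = refl
replicate-∷ʳ (suc j) = cong (3 ∷_) (replicate-∷ʳ j)

threes-node : ∀ {q N b} → 1 ≤ q → 1 ≤ b → b ≤ 2 → ∀ {J} → 0 < J →
  (∀ {j} → j < J → ¬ Val q (1 ∷ b ∷ replicate j 3) N) → ∀ {j} → j ≤ J → Node (3 + q) (1 ∷ b ∷ replicate j 3)
threes-node {b = b} 1≤q 1≤b b≤2 0<J missed {zero} _ =
  grow b 1≤q (grow 1 1≤q root (Val-prefix (1 ∷ b ∷ []) ¬v) ≤-refl ≤-refl ≤-refl)
    (Val-prefix (b ∷ []) ¬v) 1≤b 1≤b b≤2
  where ¬v = missed 0<J
threes-node {q} {b = b} 1≤q 1≤b b≤2 0<J missed {suc j} j<J =
  subst (λ as → Node (3 + q) (1 ∷ b ∷ as)) (replicate-∷ʳ j)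
    (grow 3 1≤q (threes-node 1≤q 1≤b b≤2 0<J missed (<⇒≤ j<J)) (missed j<J) (s≤s z≤n)
      (subst (_≤ 3) (sym (LastBound≡last-or (1 ∷ b ∷ replicate j 3)))
        (last-or-threes j (≤-trans b≤2 (n≤1+n 2))))
      (s≤s (s≤s (≤-trans 1≤b (m≤m+n b _)))))

-- The number `t⁻ x` is 0 at 0 and 1, is 1 at -1 and 2, and is otherwise at least 3. In the middle
-- case `t⁺ x` is a multiple of 3, on which the arguments modulo 3 rest.
data Small : ℕ → ℕ → Set where
  trivial : ∀ {c} → c ≤ 1 → Small 0 c
  single  : ∀ e → Small 1 (e * 3)
  large   : ∀ {s t} → 3 ≤ s → Small s t

small : ∀ x → Small (t⁻ x) (t⁺ x)
small (+ 0)                 = trivial z≤n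
small (+ 1)                 = trivial ≤-refl
small (+ 2)                 = single 1
small (+ suc (suc (suc n))) = large (s≤s (s≤s (m≤n⇒m≤o+n n (s≤s z≤n))))
small -[1+ 0 ]              = single 0
small -[1+ suc n ]          = large (s≤s (s≤s (m≤n⇒m≤o+n n (s≤s z≤n))))

Rep-threes : ∀ j {A D} → Rep (replicate j 3) A D → A < 3 → A ≡ 0 × ∃ λ i → D ≡ i * 3
Rep-threes zero nil _ = refl , 0 , refl
Rep-threes (suc j) (cons {A = A} {D = D} x refl refl r) A<3 with Rep-threes j r (≤-<-trans (m≤n+m A _) A<3) | t⁻ x in eq
... | refl , i , refl | zero  = refl , t⁺ x + i , lem (t⁺ x) i
  where
  lem : ∀ t i → 3 * t + i * 3 ≡ (t + i) * 3
  lem = solve-∀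
... | refl , i , refl | suc t = contradiction
  (≤-trans (m≤m+n 3 (t * 3)) (≤-trans (≤-reflexive (*-comm (suc t) 3)) (m≤m+n _ 0)))
  (<⇒≱ (subst (λ t → 3 * t + 0 < 3) eq A<3))

mod3 : ∀ X Y c → X * 3 ≡ c + Y * 3 → c % 3 ≡ 0
mod3 X Y c eq = trans (sym ([m+kn]%n≡m%n c Y 3)) (trans (cong (_% 3) (sym eq)) (m*n%n≡0 X 3))

-- The pairs (s , t) and (s′ , t′) stand for the values of (t⁻ , t⁺) at the variables of 1 and b,
-- and i * 3 for the contribution of the coefficients 3, whose variables are 0 or 1.
Avoids : ℕ → ℕ → ℕ → Set
Avoids q b N = ∀ {s t s′ t′} i → Small s t → Small s′ t′ → 1 ≤ 1 * s + (b * s′ + 0) → 1 * s + (b * s′ + 0) < 3 →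
               q * (1 * s + (b * s′ + 0)) + (1 * t + (b * t′ + 0) + i * 3) ≢ N

-- `N < 3 q` forces `A < 3`, and `A = 0` gives at most the sum; `Avoids` rules out the rest.
threes-missed : ∀ {q b N j} → Avoids q b N → N < 3 * q → 1 + (b + j * 3) < N → ¬ Val q (1 ∷ b ∷ replicate j 3) N
threes-missed {q} {b} {N} {j} avoid N<3q sum<N (val {A} r eq) = go (A <? 3) r eq
  where
  go : ∀ {A D} → Dec (A < 3) → Rep (1 ∷ b ∷ replicate j 3) A D → q * A + D ≡ N → ⊥
  go {A} {D} (no A≮3) r eq = <⇒≱ N<3q (≤-trans (≤-trans (≤-reflexive (*-comm 3 q)) (*-monoʳ-≤ q (≮⇒≥ A≮3)))
    (≤-trans (m≤m+n (q * A) D) (≤-reflexive eq)))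
  go {zero} {D} (yes _) r eq = <⇒≱ sum<N (subst (_≤ 1 + (b + j * 3)) (trans (cong (_+ D) (sym (*-zeroʳ q))) eq)
    (subst (λ s → D ≤ 1 + (b + s)) (sum-replicate j 3) (Rep-bound r)))
  go {suc A} (yes A<3) (cons x e₁ refl (cons {A = A₂} y refl refl r)) eq
    with Rep-threes j r (≤-<-trans (≤-trans (m≤n+m A₂ (b * t⁻ y)) (≤-trans (m≤n+m _ (1 * t⁻ x)) (≤-reflexive e₁))) A<3)
  ... | refl , i , refl = avoid i (small x) (small y) (subst (1 ≤_) (sym e₁) (s≤s z≤n)) (subst (_< 3) (sym e₁) A<3)
    (trans (cong₂ (λ A D → q * A + D) e₁ (lem (t⁺ x) b (t⁺ y) i)) eq)
    where
    lem : ∀ s b t i → 1 * s + (b * t + 0) + i * 3 ≡ 1 * s + (b * t + i * 3)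
    lem = solve-∀

Run-threes : ∀ J as → 2 ≤ sum as → Run as 0 → Run (replicate J 3 ++ as) 0
Run-threes zero    as 2≤s run = run
Run-threes (suc J) as 2≤s run =
  Run-∷ (s≤s (≤-trans 2≤s (≤-trans (m≤n+m (sum as) (sum (replicate J 3))) (≤-reflexive (sym (sum-++ (replicate J 3) as))))))
    (Run-threes J as 2≤s run)

-- `A = 0` suffices: no coefficient exceeds 1 plus the sum of those before it, so variables 0 and 1
-- reach everything up to the sum.
threes-below-sum : ∀ {q b N} J → 1 ≤ b → b ≤ 2 → N ≤ 1 + (b + J * 3) → Val q (1 ∷ b ∷ replicate J 3) N
threes-below-sum {q} {b} {N} J 1≤b b≤2 N≤ =
  val (Rep-resp-↭ (Perm.++-comm (replicate J 3) (1 ∷ b ∷ []))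
        (Run-threes J (1 ∷ b ∷ []) (s≤s (≤-trans 1≤b (m≤m+n b 0)))
          (λ i≤ → Rep-resp-↭ (Perm.++-comm (b ∷ []) (1 ∷ []))
            (Run-∷ b≤2 (Run-∷ ≤-refl λ { z≤n → nil }) (≤-trans i≤ (≤-reflexive (lem₁ b)))))
          (≤-trans N≤ (≤-reflexive (trans (cong (λ s → 1 + (b + s)) (sym (sum-replicate J 3)))
            (sym (sum-↭ (Perm.++-comm (replicate J 3) (1 ∷ b ∷ [])))))))))
      (cong (_+ N) (*-zeroʳ q))
  where
  lem₁ : ∀ b → 1 + (b + 0) ≡ b + (1 + 0)
  lem₁ = solve-∀

-- Descends by `3 q` at a time, with 3 as the frequent coefficient of `Val-shift`.
threes-universal : ∀ {k q b J} → Large k q → suc k + 3 ≤ J →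
  (∀ {N} → N < 3 * q → Val q (1 ∷ b ∷ replicate J 3) N) →
  ∀ N → N < suc k * suc q → Val q (1 ∷ b ∷ replicate J 3) N
threes-universal {k} {q} {b} {J} big many base = <-rec _ λ N rec N<K → case N <? 3 * q of λ where
    (yes N<3q) → base N<3q
    (no N≮3q) → subst (λ as → Val q (1 ∷ b ∷ as) N) (++-identityʳ (replicate J 3))
      (Val-shift 2 (1 ∷ b ∷ []) J [] big many N<K (≮⇒≥ N≮3q)
        (subst (λ as → Val q (1 ∷ b ∷ as) (N ∸ 3 * q)) (sym (++-identityʳ (replicate J 3)))
          (rec (∸-monoʳ-< 0<3q (≮⇒≥ N≮3q)) (≤-<-trans (m∸n≤m N (3 * q)) N<K))))
  where
  0<3q : 0 < 3 * q
  0<3q = ≤-trans (s≤s z≤n) (≤-trans (k<q big) (m≤m+n q _))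

too-large : ∀ b s s′ → 1 ≤ b → 3 ≤ s ⊎ 3 ≤ s′ → ¬ 1 * s + (b * s′ + 0) < 3
too-large b s s′ 1≤b (inj₁ 3≤s)  = ≤⇒≯ (≤-trans 3≤s (≤-trans (m≤m+n s 0) (m≤m+n (1 * s) _)))
too-large b s s′ 1≤b (inj₂ 3≤s′) =
  ≤⇒≯ (≤-trans 3≤s′ (≤-trans (m≤n*m s′ b ⦃ >-nonZero 1≤b ⦄) (≤-trans (m≤m+n (b * s′) 0) (m≤n+m _ (1 * s)))))

1+c≢0 : ∀ {c} → c ≤ 1 → (1 + c) % 3 ≢ 0
1+c≢0 z≤n       ()
1+c≢0 (s≤s z≤n) ()

2+2c≢0 : ∀ {c} → c ≤ 1 → (2 + 2 * c) % 3 ≢ 0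
2+2c≢0 z≤n       ()
2+2c≢0 (s≤s z≤n) ()

-- `N = 3 q - 1` is 2 modulo 3, whereas `q A ≡ 0` and `D` is 0 or 1.
avoids₀ : ∀ w {N} → N + 1 ≡ 3 * w * 3 → Avoids (w * 3) 1 N
avoids₀ w N≡ i (trivial _) (trivial _) () _ _
avoids₀ w N≡ i (single e) (trivial {c} c≤1) _ _ refl =
  1+c≢0 c≤1 (mod3 (3 * w) (w + e + i) (1 + c) (trans (sym N≡) (lem w e c i)))
  where
  lem : ∀ w e c i → w * 3 * (1 * 1 + (1 * 0 + 0)) + (1 * (e * 3) + (1 * c + 0) + i * 3) + 1 ≡ 1 + c + (w + e + i) * 3
  lem = solve-∀
avoids₀ w N≡ i (trivial {c} c≤1) (single e) _ _ refl =
  1+c≢0 c≤1 (mod3 (3 * w) (w + e + i) (1 + c) (trans (sym N≡) (lem w e c i)))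
  where
  lem : ∀ w e c i → w * 3 * (1 * 0 + (1 * 1 + 0)) + (1 * c + (1 * (e * 3) + 0) + i * 3) + 1 ≡ 1 + c + (w + e + i) * 3
  lem = solve-∀
avoids₀ w N≡ i (single e) (single e′) _ _ refl with mod3 (3 * w) (2 * w + e + e′ + i) 1 (trans (sym N≡) (lem w e e′ i))
  where
  lem : ∀ w e e′ i → w * 3 * (1 * 1 + (1 * 1 + 0)) + (1 * (e * 3) + (1 * (e′ * 3) + 0) + i * 3) + 1 ≡ 1 + (2 * w + e + e′ + i) * 3
  lem = solve-∀
... | ()
avoids₀ w N≡ {s} {_} {s′} i (large p) _ _ A<3 _ = too-large 1 s s′ ≤-refl (inj₁ p) A<3
avoids₀ w N≡ {s} {_} {s′} i _ (large p) _ A<3 _ = too-large 1 s s′ ≤-refl (inj₂ p) A<3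

-- `N = 3 q - 3` is 0 modulo 3, whereas `q A + D` is 1 or 2 for `A = 1` and 2 for `A = 2`.
avoids₁ : ∀ w {N} → N ≡ 3 * w * 3 → Avoids (1 + w * 3) 1 N
avoids₁ w N≡ i (trivial _) (trivial _) () _ _
avoids₁ w N≡ i (single e) (trivial {c} c≤1) _ _ refl =
  1+c≢0 c≤1 (mod3 (3 * w) (w + e + i) (1 + c) (trans (sym N≡) (lem w e c i)))
  where
  lem : ∀ w e c i → (1 + w * 3) * (1 * 1 + (1 * 0 + 0)) + (1 * (e * 3) + (1 * c + 0) + i * 3) ≡ 1 + c + (w + e + i) * 3
  lem = solve-∀
avoids₁ w N≡ i (trivial {c} c≤1) (single e) _ _ refl =
  1+c≢0 c≤1 (mod3 (3 * w) (w + e + i) (1 + c) (trans (sym N≡) (lem w e c i)))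
  where
  lem : ∀ w e c i → (1 + w * 3) * (1 * 0 + (1 * 1 + 0)) + (1 * c + (1 * (e * 3) + 0) + i * 3) ≡ 1 + c + (w + e + i) * 3
  lem = solve-∀
avoids₁ w N≡ i (single e) (single e′) _ _ refl with mod3 (3 * w) (2 * w + e + e′ + i) 2 (trans (sym N≡) (lem w e e′ i))
  where
  lem : ∀ w e e′ i → (1 + w * 3) * (1 * 1 + (1 * 1 + 0)) + (1 * (e * 3) + (1 * (e′ * 3) + 0) + i * 3) ≡ 2 + (2 * w + e + e′ + i) * 3
  lem = solve-∀
... | ()
avoids₁ w N≡ {s} {_} {s′} i (large p) _ _ A<3 _ = too-large 1 s s′ ≤-refl (inj₁ p) A<3
avoids₁ w N≡ {s} {_} {s′} i _ (large p) _ A<3 _ = too-large 1 s s′ ≤-refl (inj₂ p) A<3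

-- Again `N = 3 q - 3`. For `A = 1` the value is `2 + 2 c` modulo 3, and for `A = 2` it is `1 + c`,
-- with `c ≤ 1`.
avoids₂ : ∀ w {N} → N ≡ (3 * w + 1) * 3 → Avoids (2 + w * 3) 2 N
avoids₂ w N≡ i (trivial _) (trivial _) () _ _
avoids₂ w N≡ i (single e) (trivial {c} c≤1) _ _ refl =
  2+2c≢0 c≤1 (mod3 (3 * w + 1) (w + e + i) (2 + 2 * c) (trans (sym N≡) (lem w e c i)))
  where
  lem : ∀ w e c i → (2 + w * 3) * (1 * 1 + (2 * 0 + 0)) + (1 * (e * 3) + (2 * c + 0) + i * 3) ≡ 2 + 2 * c + (w + e + i) * 3
  lem = solve-∀
avoids₂ w N≡ i (trivial {c} c≤1) (single e) _ _ refl =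
  1+c≢0 c≤1 (mod3 (3 * w + 1) (2 * w + 2 * e + i + 1) (1 + c) (trans (sym N≡) (lem w e c i)))
  where
  lem : ∀ w e c i → (2 + w * 3) * (1 * 0 + (2 * 1 + 0)) + (1 * c + (2 * (e * 3) + 0) + i * 3) ≡ 1 + c + (2 * w + 2 * e + i + 1) * 3
  lem = solve-∀
avoids₂ w N≡ i (single _) (single _) _ (s≤s (s≤s (s≤s ()))) _
avoids₂ w N≡ {s} {_} {s′} i (large p) _ _ A<3 _ = too-large 2 s s′ (s≤s z≤n) (inj₁ p) A<3
avoids₂ w N≡ {s} {_} {s′} i _ (large p) _ A<3 _ = too-large 2 s s′ (s≤s z≤n) (inj₂ p) A<3

k+6≤q : ∀ {k q} → Large k q → suc k + 5 ≤ q
k+6≤q {k} {q} big = by-≤ (K * K * K + 3 * (K * K) + K)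
  (+-mono-≤ (Large.bound₁ big) (≤-trans (Large.5≤k big) (n≤1+n k))) (lem K q)
  where
  K = suc k
  lem : ∀ K q → K + 5 + (q + K) + (K * K * K + 3 * (K * K) + K) ≡ q + (K * ((K + 2) * suc K + 1) + 5)
  lem = solve-∀

-- A leaf of rank above `r` has a parent of rank at least `r` with a truant, against
-- `no-long-truant`.
leaf-rank-≤ : ∀ C {k q r} → GoodConstant C → Floor C k → Large k q → q ≤ r → (q % 3 ≡ 2 ⊎ suc q ≤ r) →
              ∀ as → Leaf (3 + q) as → length as ≤ r
leaf-rank-≤ C good fl big q≤r longer _ (root , _) = z≤n
leaf-rank-≤ C {q = q} {r} good fl big q≤r longer _ (child {as} a T node truant _ _ , _) =
  ≮⇒≥ λ r<n → let r≤n = s≤s⁻¹ (subst (suc r ≤_) length-∷ʳ r<n) in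
    no-long-truant big node truant′ (truant-bound C good fl (Chain⇒IsForm (node-chain 1≤q node)) truant′)
      (≤-trans q≤r r≤n) (Sum.map₂ (λ q<r → ≤-trans q<r r≤n) longer)
  where
  truant′ = IsTruant⇒Truant q as T truant
  1≤q : 1 ≤ q
  1≤q = ≤-trans (s≤s z≤n) (k+6≤q big)
  length-∷ʳ : length (as ∷ʳ a) ≡ suc (length as)
  length-∷ʳ = trans (length-++ as) (+-comm (length as) 1)

threes-leaf : ∀ C {k q b N J} → GoodConstant C → Floor C k → Large k q → 1 ≤ b → b ≤ 2 → q ≤ 2 + J →
  Avoids q b N → N < 3 * q → b + J * 3 ≤ N + 1 →
  (∀ {N} → N < 3 * q → Val q (1 ∷ b ∷ replicate J 3) N) → Leaf (3 + q) (1 ∷ b ∷ replicate J 3)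
threes-leaf C {k} {q} {b} {N} {J} good fl big 1≤b b≤2 q≤ avoid N<3q sum≤ base =
  node , good⇒universal C good fl (Chain⇒IsForm (node-chain 1≤q node)) (λ {N} → threes-universal big many base N)
  where
  many : suc k + 3 ≤ J
  many = by-≤ 0 (≤-trans (k+6≤q big) q≤) (lem (suc k) J)
    where
    lem : ∀ K J → K + 3 + (2 + J) + 0 ≡ J + (K + 5)
    lem = solve-∀
  0<J : 0 < J
  0<J = ≤-trans (s≤s z≤n) many
  1≤q : 1 ≤ q
  1≤q = ≤-trans (s≤s z≤n) (k+6≤q big)
  missed′ : ∀ {j} → j < J → ¬ Val q (1 ∷ b ∷ replicate j 3) N
  missed′ {j} j<J = threes-missed avoid N<3q (by-≤ 0 (+-mono-≤ sum≤ (*-monoˡ-≤ 3 j<J)) (lem b j J N))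
    where
    lem : ∀ b j J N → suc (1 + (b + j * 3)) + (N + 1 + J * 3) + 0 ≡ N + (b + J * 3 + suc j * 3)
    lem = solve-∀
  node : Node (3 + q) (1 ∷ b ∷ replicate J 3)
  node = threes-node 1≤q 1≤b b≤2 0<J missed′ ≤-refl

-- The coefficients add up to `3 q - 1`, so everything below `3 q` comes from variables 0 and 1; the
-- same holds in `leaf₁`.
leaf₀ : ∀ C {k} w → GoodConstant C → Floor C k → Large k (suc w * 3) →
        Leaf (3 + suc w * 3) (1 ∷ 1 ∷ replicate (2 + w * 3) 3)
leaf₀ C w good fl big = threes-leaf C good fl big ≤-refl (s≤s z≤n) (≤-trans (n≤1+n _) (≤-reflexive (lem₁ w)))
  (avoids₀ (suc w) {8 + w * 9} (lem₂ w)) (≤-reflexive (lem₃ w)) (by-≤ 2 (z≤n {0}) (lem₅ w))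
  (λ {N} N<3q → threes-below-sum (2 + w * 3) ≤-refl (s≤s z≤n) (s≤s⁻¹ (≤-trans N<3q (≤-reflexive (lem₄ w)))))
  where
  lem₁ : ∀ w → suc (suc w * 3) ≡ 2 + (2 + w * 3)
  lem₁ = solve-∀
  lem₂ : ∀ w → 8 + w * 9 + 1 ≡ 3 * suc w * 3
  lem₂ = solve-∀
  lem₃ : ∀ w → suc (8 + w * 9) ≡ 3 * (suc w * 3)
  lem₃ = solve-∀
  lem₄ : ∀ w → 3 * (suc w * 3) ≡ suc (1 + (1 + (2 + w * 3) * 3))
  lem₄ = solve-∀
  lem₅ : ∀ w → 1 + (2 + w * 3) * 3 + 0 + 2 ≡ 8 + w * 9 + 1 + 0
  lem₅ = solve-∀

leaf₁ : ∀ C {k} w → GoodConstant C → Floor C k → Large k (1 + w * 3) →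
        Leaf (4 + w * 3) (1 ∷ 1 ∷ replicate (w * 3) 3)
leaf₁ C w good fl big = threes-leaf C good fl big ≤-refl (s≤s z≤n) (n≤1+n _)
  (avoids₁ w refl) (by-≤ 2 (z≤n {0}) (lem₁ w)) (≤-reflexive (lem₂ w))
  (λ {N} N<3q → threes-below-sum (w * 3) ≤-refl (s≤s z≤n) (s≤s⁻¹ (≤-trans N<3q (≤-reflexive (lem₃ w)))))
  where
  lem₁ : ∀ w → suc (3 * w * 3) + 0 + 2 ≡ 3 * (1 + w * 3) + 0
  lem₁ = solve-∀
  lem₂ : ∀ w → 1 + w * 3 * 3 ≡ 3 * w * 3 + 1
  lem₂ = solve-∀
  lem₃ : ∀ w → 3 * (1 + w * 3) ≡ suc (1 + (1 + w * 3 * 3))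
  lem₃ = solve-∀

-- The coefficients add up to `3 q - 3` only; `3 q - 2` and `3 q - 1` are attained with `A = 1`, the
-- first two variables being (-1 , 1) and (-1 , 0).
leaf₂ : ∀ C {k} w → GoodConstant C → Floor C k → Large k (2 + w * 3) →
        Leaf (5 + w * 3) (1 ∷ 2 ∷ replicate (w * 3) 3)
leaf₂ C {k} w good fl big = threes-leaf C good fl big (s≤s z≤n) ≤-refl ≤-refl
  (avoids₂ w refl) (by-≤ 2 (z≤n {0}) (lem₁ w)) (by-≤ 2 (z≤n {0}) (lem₂ w)) base
  where
  lem₁ : ∀ w → suc ((3 * w + 1) * 3) + 0 + 2 ≡ 3 * (2 + w * 3) + 0
  lem₁ = solve-∀
  lem₂ : ∀ w → 2 + w * 3 * 3 + 0 + 2 ≡ (3 * w + 1) * 3 + 1 + 0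
  lem₂ = solve-∀
  lem₃ : ∀ w → 3 * (2 + w * 3) ≡ 6 + w * 3 * 3
  lem₃ = solve-∀
  1≤w : 1 ≤ w
  1≤w = *-cancelʳ-≤ 1 w 3 (+-cancelˡ-≤ 2 3 (w * 3) (≤-trans (m≤n+m 5 (suc k)) (k+6≤q big)))
  attained : ∀ {D} j y → Rep (1 ∷ 2 ∷ []) 1 D → j ≤ w * 3 → (2 + w * 3) * (1 + 0) + (D + j * 3) ≡ y →
             Val (2 + w * 3) (1 ∷ 2 ∷ replicate (w * 3) 3) y
  attained j y r j≤ eq = val (Rep-++ r (Rep-multiple 3 j≤)) eq
  lem₄ : ∀ w → (2 + w * 3) * (1 + 0) + (2 + 2 * w * 3) ≡ 4 + w * 3 * 3
  lem₄ = solve-∀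
  lem₅ : ∀ w → (2 + w * 3) * (1 + 0) + (0 + suc (2 * w) * 3) ≡ 5 + w * 3 * 3
  lem₅ = solve-∀
  2w+1≤3w : suc (2 * w) ≤ w * 3
  2w+1≤3w = by-≤ 0 1≤w (lem w)
    where
    lem : ∀ w → suc (2 * w) + w + 0 ≡ w * 3 + 1
    lem = solve-∀
  base : ∀ {N} → N < 3 * (2 + w * 3) → Val (2 + w * 3) (1 ∷ 2 ∷ replicate (w * 3) 3) N
  base {N} N<3q with N ≤? 1 + (2 + w * 3 * 3)
  ... | yes N≤ = threes-below-sum (w * 3) (s≤s z≤n) ≤-refl N≤
  ... | no N≰ with N ≟ 4 + w * 3 * 3
  ...   | yes refl = attained (2 * w) _ (cons -[1+ 0 ] refl refl (cons (+ 1) refl refl nil))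
            (≤-trans (n≤1+n _) 2w+1≤3w) (lem₄ w)
  ...   | no N≢ = attained (suc (2 * w)) _ (cons -[1+ 0 ] refl refl (cons (+ 0) refl refl nil)) 2w+1≤3w
            (trans (lem₅ w) (≤-antisym (≤∧≢⇒< (≰⇒> N≰) (N≢ ∘ sym)) (s≤s⁻¹ (≤-trans N<3q (≤-reflexive (lem₃ w))))))

theorem2p3 : (C : ℚᵘ) → GoodConstant C →
    (m : ℕ) → 3 ≤ m → (+ 6 ℚᵘ./ 1) ℚᵘ.* C ℚᵘ.* C ℚᵘ.* (C ℚᵘ.+ (+ 1 ℚᵘ./ 1)) ℚᵘ.< (+ m ℚᵘ./ 1) →
    ((m % 3 ≢ 2 → MaxLeafRank m (m ∸ 2)) × (m % 3 ≡ 2 → MaxLeafRank m (m ∸ 3)))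
theorem2p3 C good (suc (suc (suc q))) (s≤s (s≤s (s≤s z≤n))) lt with floor C good
... | k , 5≤k , fl = (λ m%3≢2 → long-leaf m%3≢2 , leaf-rank-≤ C good fl big (n≤1+n q) (inj₂ ≤-refl)) ,
                     (λ m%3≡2 → short-leaf m%3≡2 , leaf-rank-≤ C good fl big ≤-refl (inj₁ (trans (sym m%3≡q%3) m%3≡2)))
  where
  big : Large k q
  big = Floor⇒Large 5≤k fl lt
  m%3≡q%3 : (3 + q) % 3 ≡ q % 3
  m%3≡q%3 = trans (cong (_% 3) (+-comm 3 q)) ([m+n]%n≡m%n q 3)
  q≡ : ∀ {r} → q % 3 ≡ r → q ≡ r + q / 3 * 3
  q≡ eq = trans (m≡m%n+[m/n]*n q 3) (cong (_+ q / 3 * 3) eq)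
  LeafOfRank : ℕ → ℕ → Set
  LeafOfRank q r = Σ (List ℕ) λ as → Leaf (3 + q) as × length as ≡ r
  long₀ : ∀ w → Large k (w * 3) → LeafOfRank (w * 3) (suc (w * 3))
  long₀ zero big = contradiction (≤-trans (m≤n+m 5 (suc k)) (k+6≤q big)) λ ()
  long₀ (suc w) big = _ , leaf₀ C w good fl big , cong (_+_ 2) (length-replicate (2 + w * 3))
  long-leaf : (3 + q) % 3 ≢ 2 → LeafOfRank q (suc q)
  long-leaf m%3≢2 = by-residue (q % 3) refl (m%n<n q 3)
    where
    by-residue : ∀ r → q % 3 ≡ r → r < 3 → LeafOfRank q (suc q)
    by-residue 0 eq _ = subst (λ q → LeafOfRank q (suc q)) (sym (q≡ eq)) (long₀ (q / 3) (subst (Large k) (q≡ eq) big))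
    by-residue 1 eq _ = subst (λ q → LeafOfRank q (suc q)) (sym (q≡ eq))
      (_ , leaf₁ C (q / 3) good fl (subst (Large k) (q≡ eq) big) , cong (_+_ 2) (length-replicate (q / 3 * 3)))
    by-residue 2 eq _ = contradiction (trans m%3≡q%3 eq) m%3≢2
    by-residue (suc (suc (suc _))) _ (s≤s (s≤s (s≤s ())))
  short-leaf : (3 + q) % 3 ≡ 2 → LeafOfRank q q
  short-leaf m%3≡2 = subst (λ q → LeafOfRank q q) (sym q≡2)
      (_ , leaf₂ C (q / 3) good fl (subst (Large k) q≡2 big) , cong (_+_ 2) (length-replicate (q / 3 * 3)))
    where
    q≡2 : q ≡ 2 + q / 3 * 3
    q≡2 = q≡ (trans (sym m%3≡q%3) m%3≡2)
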